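{- Let $m,n\ge 1$ and let $G$ be a bridge sum (at any two vertices, one from each graph) of a tree on $m$ vertices and the complete graph on $n$ vertices. Then all orbits of toric promotion on $G$ have length $(m+n)(m+n-1)$.
   Context: Toric promotion. Let $G=(V,E)$ be a finite simple graph (undirected, no loops, no multiple edges) on $N$ vertices. A labeling of $G$ is a bijection $\sigma:V\to\mathbb{Z}/N\mathbb{Z}=\{1,\dots,N\}$ (addition modulo $N$). A state is a pair $(\sigma,i)$ with $\sigma$ a labeling of $G$ and $i\in\mathbb{Z}/N\mathbb{Z}$; $\Omega_G$ is the set of all states. Toric promotion is the map $\mathrm{TPro}:\Omega_G\to\Omega_G$ given by $\mathrm{TPro}(\sigma,i)=(\sigma,i+1)$ if $\{\sigma^{ -1}(i),\sigma^{ -1}(i+1)\}\in E$, and $\mathrm{TPro}(\sigma,i)=((i,i+1)\circ\sigma,\,i+1)$ otherwise, where $(i,i+1)$ is the permutation of $\mathbb{Z}/N\mathbb{Z}$ swapping $i$ and $i+1$. It is a bijection of $\Omega_G$. The length of the orbit containing $(\sigma,i)$ is the least $L\ge 1$ with $\mathrm{TPro}^L(\sigma,i)=(\sigma,i)$. Bridge sum. For graphs $G_1=(V_1,E_1)$, $G_2=(V_2,E_2)$ with disjoint vertex sets and vertices $v_1\in V_1$, $v_2\in V_2$, the bridge sum of $G_1$ and $G_2$ at $v_1$ and $v_2$ is the graph with vertex set $V_1\cup V_2$ and edge set $E_1\cup E_2\cup\{\{v_1,v_2\}\}$. -}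

module Defs where

open import Data.Fin.Base using (Fin; toℕ)
open import Data.Fin.Permutation using (transpose)
open import Data.Fin.Properties using (+↔⊎; inj⇒≟; nonZeroIndex)
open import Data.List.Base using (List; []; _∷_; _++_; [_]; length)
open import Data.List.Relation.Unary.Linked using (Linked)
open import Data.List.Relation.Unary.Unique.Propositional using (Unique)
open import Data.Nat.Base using (ℕ; _+_; _≤_; suc)
open import Data.Nat.DivMod using (_mod_)
open import Data.Nat.GeneralisedArithmetic using (iterate)
open import Data.Product.Base using (_×_; _,_)
open import Data.Sum.Base using (_⊎_; inj₁; inj₂)
open import Data.Sum.Function.Propositional using (_⊎-↔_)
open import Function.Bundles using (_↔_; Inverse)
open import Function.Construct.Composition using (_↔-∘_)
open import Function.Construct.Symmetry using (↔-sym)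
open import Function.Properties.Inverse using (↔⇒↣)
open import Level using (0ℓ)
open import Relation.Binary.Construct.Closure.ReflexiveTransitive using (Star)
open import Relation.Binary.Core using (Rel)
open import Relation.Binary.Definitions
  using (Decidable; DecidableEquality; Irreflexive; Symmetric)
open import Relation.Binary.PropositionalEquality.Core using (_≡_; _≢_; refl)
open import Relation.Nullary.Decidable using (Dec; yes; no)
open import Relation.Nullary.Negation using (¬_)

-- Decidability of adjacency is automatic classically; constructively it is
-- what makes toric promotion a function.

record Graph (N : ℕ) : Set₁ where
  field
    Vertex   : Set
    finite   : Vertex ↔ Fin N
    Adj      : Rel Vertex 0ℓ
    adj?     : Decidable Adj
    adj-sym  : Symmetric Adj
    loopless : Irreflexive _≡_ Adj

  _≟ᵛ_ : DecidableEquality Vertex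
  _≟ᵛ_ = inj⇒≟ (↔⇒↣ finite)

module _ {N : ℕ} (G : Graph N) where
  open Graph G

  Connected : Set
  Connected = ∀ u v → Star Adj u v

  -- The cycle v, vs, v: at least three vertices, without repetition.
  IsCycle : Vertex → List Vertex → Set
  IsCycle v vs = 2 ≤ length vs × Unique (v ∷ vs) × Linked Adj (v ∷ vs ++ [ v ])

  Acyclic : Set
  Acyclic = ∀ v vs → ¬ IsCycle v vs

  -- The empty graph satisfies this; it is excluded by requiring 1 ≤ N.
  IsTree : Set
  IsTree = Connected × Acyclic

  IsComplete : Set
  IsComplete = ∀ u v → u ≢ v → Adj u v

module _ {m n : ℕ} (G₁ : Graph m) (G₂ : Graph n) where
  private
    module G₁ = Graph G₁
    module G₂ = Graph G₂

  data BridgeAdj (v₁ : G₁.Vertex) (v₂ : G₂.Vertex) :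
                 Rel (G₁.Vertex ⊎ G₂.Vertex) 0ℓ where
    left    : ∀ {a b} → G₁.Adj a b → BridgeAdj v₁ v₂ (inj₁ a) (inj₁ b)
    right   : ∀ {a b} → G₂.Adj a b → BridgeAdj v₁ v₂ (inj₂ a) (inj₂ b)
    bridge₁ : BridgeAdj v₁ v₂ (inj₁ v₁) (inj₂ v₂)
    bridge₂ : BridgeAdj v₁ v₂ (inj₂ v₂) (inj₁ v₁)

  bridgeAdj? : ∀ v₁ v₂ → Decidable (BridgeAdj v₁ v₂)
  bridgeAdj? v₁ v₂ (inj₁ a) (inj₁ b) with G₁.adj? a b
  ... | yes p = yes (left p)
  ... | no ¬p = no λ { (left p) → ¬p p }
  bridgeAdj? v₁ v₂ (inj₂ a) (inj₂ b) with G₂.adj? a b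
  ... | yes p = yes (right p)
  ... | no ¬p = no λ { (right p) → ¬p p }
  bridgeAdj? v₁ v₂ (inj₁ a) (inj₂ b) with a G₁.≟ᵛ v₁ | b G₂.≟ᵛ v₂
  ... | yes refl | yes refl = yes bridge₁
  ... | no a≢v₁  | _        = no λ { bridge₁ → a≢v₁ refl }
  ... | yes _    | no b≢v₂  = no λ { bridge₁ → b≢v₂ refl }
  bridgeAdj? v₁ v₂ (inj₂ b) (inj₁ a) with a G₁.≟ᵛ v₁ | b G₂.≟ᵛ v₂
  ... | yes refl | yes refl = yes bridge₂
  ... | no a≢v₁  | _        = no λ { bridge₂ → a≢v₁ refl }
  ... | yes _    | no b≢v₂  = no λ { bridge₂ → b≢v₂ refl }

  bridgeAdj-sym : ∀ v₁ v₂ → Symmetric (BridgeAdj v₁ v₂)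
  bridgeAdj-sym v₁ v₂ (left p)  = left (G₁.adj-sym p)
  bridgeAdj-sym v₁ v₂ (right p) = right (G₂.adj-sym p)
  bridgeAdj-sym v₁ v₂ bridge₁   = bridge₂
  bridgeAdj-sym v₁ v₂ bridge₂   = bridge₁

  bridgeAdj-irrefl : ∀ v₁ v₂ → Irreflexive _≡_ (BridgeAdj v₁ v₂)
  bridgeAdj-irrefl v₁ v₂ refl (left p)  = G₁.loopless refl p
  bridgeAdj-irrefl v₁ v₂ refl (right p) = G₂.loopless refl p

  bridgeSum : G₁.Vertex → G₂.Vertex → Graph (m + n)
  bridgeSum v₁ v₂ = record
    { Vertex   = G₁.Vertex ⊎ G₂.Vertex
    ; finite   = ↔-sym +↔⊎ ↔-∘ (G₁.finite ⊎-↔ G₂.finite)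
    ; Adj      = BridgeAdj v₁ v₂
    ; adj?     = bridgeAdj? v₁ v₂
    ; adj-sym  = bridgeAdj-sym v₁ v₂
    ; loopless = bridgeAdj-irrefl v₁ v₂
    }

-- Fin N, that is {0, …, N-1}, represents ℤ/Nℤ.

next : ∀ {N} → Fin N → Fin N
next {N} i = _mod_ (suc (toℕ i)) N {{nonZeroIndex i}}

module _ {N : ℕ} (G : Graph N) where
  open Graph G

  Labeling : Set
  Labeling = Vertex ↔ Fin N

  State : Set
  State = Labeling × Fin N

  -- Labelings are compared as functions: _≡_ on _↔_ would also compare
  -- the inverse-law proofs.
  infix 4 _≈ₛ_
  _≈ₛ_ : Rel State 0ℓ
  (σ , i) ≈ₛ (τ , j) = (∀ v → Inverse.to σ v ≡ Inverse.to τ v) × i ≡ j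

  TPro : State → State
  TPro (σ , i) with adj? (Inverse.from σ i) (Inverse.from σ (next i))
  ... | yes _ = σ , next i
  ... | no  _ = transpose i (next i) ↔-∘ σ , next i

  record OrbitLength (s : State) (L : ℕ) : Set where
    field
      positive : 1 ≤ L
      returns  : iterate TPro s L ≈ₛ s
      least    : ∀ k → 1 ≤ k → iterate TPro s k ≈ₛ s → L ≤ k

{-# OPTIONS --safe #-}
-- Call the vertex labelled i the walker.  Toric promotion lets the walker meet the
-- other M = N - 1 vertices cyclically: each of them sits in a slot, the walker meets
-- the slots in turn, and swaps places with the vertex in the slot exactly when the
-- two are adjacent.  In this description
--
--   * each tree edge, and the bridge, owns a slot for ever: the slot holds the endpoint
--     farther from the walker, and is where the walker crosses the edge;
--   * the clique owns the remaining n - 1 slots, its cyclic order never changes, and a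
--     round of M steps started by the walker in the clique rotates it by one place.
--
-- With rounds starting at the bridge slot, the walker together with the time modulo M
-- thus determines the whole state up to a shift of the labels, and moves by a
-- permutation of N * M configurations.  This permutation is a single cycle: after
-- crossing an edge of the tree the walker must by periodicity come back, and can only
-- do so through the same edge and hence in the same slot, so crossings can be
-- ignored when asking which configurations are visited.  So the orbit has
-- period N * M, a multiple of N.  No shorter period is possible, because the bridge is
-- crossed out of the clique in only one configuration.
module Submission where

open import Defs
open import Data.Bool.Base using (if_then_else_; Bool; true; false)
open import Data.Empty using (⊥)
open import Data.Fin.Base using (Fin; toℕ; fromℕ<; zero; suc; fromℕ; inject₁)
import Data.Fin.Permutation.Components as Components
open import Data.Fin.Properties
  using (pigeonhole; injective⇒≤; any?; toℕ<n; toℕ-injective; toℕ-fromℕ<; toℕ-fromℕ; toℕ-inject₁;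
         inject₁-injective; fromℕ≢inject₁; fromℕ<-injective; fromℕ<-cong; nonZeroIndex; *↔×; +↔⊎)
  renaming (_≟_ to _≟ᶠ_)
open import Data.List.Base using (List; []; _∷_; _++_; [_])
open import Data.List.Membership.DecPropositional using (_∈?_)
open import Data.List.Membership.Propositional using (_∈_)
open import Data.List.Relation.Unary.All using ([]; _∷_)
open import Data.List.Relation.Unary.All.Properties using (¬Any⇒All¬)
open import Data.List.Relation.Unary.AllPairs using ([]; _∷_)
open import Data.List.Relation.Unary.Any using (here; there)
open import Data.List.Relation.Unary.Linked using (Linked; [-]; _∷_)
open import Data.List.Relation.Unary.Unique.Propositional using (Unique)
open import Data.Maybe.Base using (Maybe; just; nothing; maybe′; is-nothing)
open import Data.Maybe.Properties using (just-injective; ≡-dec)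
open import Data.Nat.Base
open import Data.Nat.DivMod
open import Data.Nat.GeneralisedArithmetic using (iterate)
open import Data.Nat.Induction using (<-wellFounded)
open import Data.Nat.Properties
open import Data.Product.Base using (_×_; _,_; ∃; ∃-syntax; proj₁; proj₂)
open import Data.Product.Function.NonDependent.Propositional using (_×-↔_)
open import Data.Sum.Base using (_⊎_; inj₁; inj₂)
open import Data.Sum.Function.Propositional using (_⊎-↔_)
open import Data.Sum.Properties
  using (inj₁-injective; inj₂-injective) renaming (≡-dec to ⊎-≡-dec)
open import Function.Base using (_∘_)
open import Function.Bundles using (_↔_; Inverse)
open import Function.Construct.Composition using (_↔-∘_)
open import Function.Construct.Identity using (↔-id)
open import Function.Construct.Symmetry using (↔-sym)
open import Function.Definitions using (Injective)
open import Induction.WellFounded using (Acc; acc)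
open import Level using (0ℓ)
open import Relation.Binary.Construct.Closure.ReflexiveTransitive
  using (Star; ε; _◅_; _◅◅_; reverse)
open import Relation.Binary.Core using (Rel)
open import Relation.Binary.Definitions using (tri<; tri≈; tri>)
open import Relation.Binary.PropositionalEquality hiding ([_])
open import Relation.Nullary using (yes; no; ¬_; contradiction; Dec)
open import Relation.Nullary.Decidable
  using (map′; _×-dec_; does; dec-true; dec-false; ¬?; decidable-stable)

-- Orbits of injections on finite sets

module _ {A : Set} (f : A → A) where

  iterate-+ : ∀ x a b → iterate f x (a + b) ≡ iterate f (iterate f x a) b
  iterate-+ x zero    b = refl
  iterate-+ x (suc a) b = iterate-+ (f x) a b

  iterate-suc : ∀ x k → iterate f x (suc k) ≡ f (iterate f x k)
  iterate-suc x zero    = refl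
  iterate-suc x (suc k) = iterate-suc (f x) k

  iterate-injective : Injective _≡_ _≡_ f →
                      ∀ k {x y} → iterate f x k ≡ iterate f y k → x ≡ y
  iterate-injective inj zero    eq = eq
  iterate-injective inj (suc k) eq = inj (iterate-injective inj k eq)

  iterate-multiple : ∀ {x p} → iterate f x p ≡ x → ∀ k → iterate f x (k * p) ≡ x
  iterate-multiple         per zero    = refl
  iterate-multiple {x} {p} per (suc k) =
    trans (iterate-+ x p (k * p))
          (trans (cong (λ z → iterate f z (k * p)) per) (iterate-multiple per k))

  iterate-% : ∀ {x p} .{{_ : NonZero p}} → iterate f x p ≡ x →
              ∀ k → iterate f x k ≡ iterate f x (k % p)
  iterate-% {x} {p} per k = begin
    iterate f x k                               ≡⟨ cong (iterate f x) (trans (m≡m%n+[m/n]*n k p) (+-comm (k % p) _)) ⟩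
    iterate f x (k / p * p + k % p)             ≡⟨ iterate-+ x (k / p * p) (k % p) ⟩
    iterate f (iterate f x (k / p * p)) (k % p) ≡⟨ cong (λ z → iterate f z (k % p)) (iterate-multiple per (k / p)) ⟩
    iterate f x (k % p)                         ∎
    where open ≡-Reasoning

module FiniteOrbit {X : Set} {K : ℕ} (X↔ : X ↔ Fin K)
                   (f : X → X) (f-injective : Injective _≡_ _≡_ f) (x : X) where
  open Inverse X↔

  private
    to-injective : ∀ {a b} → to a ≡ to b → a ≡ b
    to-injective {a} {b} eq =
      trans (sym (strictlyInverseʳ a)) (trans (cong from eq) (strictlyInverseʳ b))

  Visited : X → Set
  Visited y = ∃[ k ] iterate f x k ≡ y

  -- Two of the first `K + 1` iterates coincide by the pigeonhole principle, and injectivity cancels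
  -- the steps before the earlier one.
  returns-early : ∃[ p ] 1 ≤ p × p ≤ K × iterate f x p ≡ x
  returns-early
    with i , j , i<j , eq ← pigeonhole (n<1+n K) (λ (t : Fin (suc K)) → to (iterate f x (toℕ t))) =
    toℕ j ∸ toℕ i , m<n⇒0<n∸m i<j
    , ≤-trans (m∸n≤m (toℕ j) (toℕ i)) (≤-pred (toℕ<n j))
    , sym (iterate-injective f f-injective (toℕ i) (begin
        iterate f x (toℕ i)                           ≡⟨ to-injective eq ⟩
        iterate f x (toℕ j)                           ≡⟨ cong (iterate f x) (m∸n+n≡m (<⇒≤ i<j)) ⟨
        iterate f x (toℕ j ∸ toℕ i + toℕ i)           ≡⟨ iterate-+ f x (toℕ j ∸ toℕ i) (toℕ i) ⟩
        iterate f (iterate f x (toℕ j ∸ toℕ i)) (toℕ i) ∎))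
    where open ≡-Reasoning

  visited-step : ∀ {y} → Visited y → Visited (f y)
  visited-step (k , refl) = suc k , iterate-suc f x k

  -- The orbit is a cycle: completing `k` steps to the multiple `k * p` of a period leads back to
  -- `x`, and from there to `y`.
  visited-after : ∀ {y} → Visited y → ∀ k → ∃[ l ] iterate f (iterate f x k) l ≡ y
  visited-after {y} (i , eq) k with returns-early
  ... | p , 1≤p , _ , per = k * p ∸ k + i , (begin
    iterate f (iterate f x k) (k * p ∸ k + i)  ≡⟨ iterate-+ f x k _ ⟨
    iterate f x (k + (k * p ∸ k + i))          ≡⟨ cong (iterate f x) (+-assoc k (k * p ∸ k) i) ⟨
    iterate f x (k + (k * p ∸ k) + i)          ≡⟨ cong (λ z → iterate f x (z + i)) (m+[n∸m]≡n k≤kp) ⟩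
    iterate f x (k * p + i)                    ≡⟨ iterate-+ f x (k * p) i ⟩
    iterate f (iterate f x (k * p)) i          ≡⟨ cong (λ z → iterate f z i) (iterate-multiple f per k) ⟩
    iterate f x i                              ≡⟨ eq ⟩
    y                                          ∎)
    where
      open ≡-Reasoning
      k≤kp : k ≤ k * p
      k≤kp = subst (_≤ k * p) (*-identityʳ k) (*-monoʳ-≤ k 1≤p)

  module _ (transitive : ∀ y → Visited y) where

    -- If `x` returns after `k` steps, visiting times can be reduced modulo `k`; distinct points
    -- keep distinct times, so `Fin K` embeds in `Fin k`.
    period-least : ∀ k → 1 ≤ k → iterate f x k ≡ x → K ≤ k
    period-least k@(suc _) _ per = injective⇒≤ {f = time} λ {a} {b} eq →
      trans (sym (to∘visit a)) (trans (cong (λ t → to (iterate f x (toℕ t))) eq) (to∘visit b))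
      where
        time : Fin K → Fin k
        time a = fromℕ< (m%n<n (proj₁ (transitive (from a))) k)

        to∘visit : ∀ a → to (iterate f x (toℕ (time a))) ≡ a
        to∘visit a with transitive (from a)
        ... | t , eq = trans (cong to (trans (cong (iterate f x) (toℕ-fromℕ< (m%n<n t k)))
                                             (trans (sym (iterate-% f per t)) eq)))
                             (strictlyInverseˡ a)

    period : iterate f x K ≡ x
    period with returns-early
    ... | p , 1≤p , p≤K , per =
      subst (λ q → iterate f x q ≡ x) (≤-antisym p≤K (period-least p 1≤p per)) per

-- Rooted trees

-- The tree property enters the later argument only through this record. Acyclicity is what
-- `adj-parent` expresses: there are no edges besides the parent edges.
record Rooting {V : Set} (Adj : Rel V 0ℓ) (root : V) : Set where
  field
    parent         : V → Maybe V
    depth          : V → ℕ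
    parent-root    : parent root ≡ nothing
    parent-nothing : ∀ {u} → parent u ≡ nothing → u ≡ root
    parent-adj     : ∀ {u p} → parent u ≡ just p → Adj u p
    parent-depth   : ∀ {u p} → parent u ≡ just p → depth p < depth u
    adj-parent     : ∀ {u v} → Adj u v → parent u ≡ just v ⊎ parent v ≡ just u

least : ∀ {P : ℕ → Set} → (∀ k → Dec (P k)) → ∀ k → P k →
        ∃[ m ] P m × (∀ j → P j → m ≤ j)
least P? zero    pk = zero , pk , λ _ _ → z≤n
least {P} P? (suc k) pk with P? zero
... | yes p0 = zero , p0 , λ _ _ → z≤n
... | no ¬p0 with least {P ∘ suc} (P? ∘ suc) k pk
... | m , pm , min = suc m , pm , λ where
  zero    p0 → contradiction p0 ¬p0
  (suc j) pj → s≤s (min j pj)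

-- Indexed by the list of vertices after the first, so that absence of repetition can be stated and
-- a path can be closed into an `IsCycle`.
data Path {V : Set} (R : Rel V 0ℓ) : V → List V → V → Set where
  []  : ∀ {x} → Path R x [] x
  _∷_ : ∀ {x y z vs} → R x y → Path R y vs z → Path R x (y ∷ vs) z

module _ {N : ℕ} (G : Graph N) where
  open Graph G

  any-vertex? : ∀ {P : Vertex → Set} → (∀ v → Dec (P v)) → Dec (∃ P)
  any-vertex? {P} P? =
    map′ (λ (i , p) → from i , p)
         (λ (v , p) → to v , subst P (sym (strictlyInverseʳ v)) p)
         (any? (P? ∘ from))
    where open Inverse finite

  module _ {R : Rel Vertex 0ℓ} where

    -- Loop erasure: if the new first vertex already occurs on the path, only the part from that
    -- occurrence on is kept.
    simple-path : ∀ {x y} → Star R x y → ∃[ vs ] Path R x vs y × Unique (x ∷ vs)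
    simple-path ε = [] , [] , [] ∷ []
    simple-path {x} (_◅_ {j = z} r s) with simple-path s
    ... | vs , p , u with _∈?_ _≟ᵛ_ x (z ∷ vs)
    ...   | no  x∉ = z ∷ vs , r ∷ p , ¬Any⇒All¬ _ x∉ ∷ u
    ...   | yes x∈ = suffix x∈ p u
      where
        suffix : ∀ {x y z vs} → x ∈ z ∷ vs → Path R z vs y → Unique (z ∷ vs) →
                 ∃[ ws ] Path R x ws y × Unique (x ∷ ws)
        suffix (here refl) p       u       = _ , p , u
        suffix (there x∈)  (r ∷ p) (_ ∷ u) = suffix x∈ p u

    close-path : ∀ {x y z vs} → (∀ {a b} → R a b → Adj a b) →
                 Path R z vs y → Adj y x → Linked Adj (z ∷ vs ++ [ x ])
    close-path R⇒Adj []      yx = yx ∷ [-]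
    close-path R⇒Adj (r ∷ p) yx = R⇒Adj r ∷ close-path R⇒Adj p yx

  Avoiding : Vertex → Vertex → Rel Vertex 0ℓ
  Avoiding x y a b = Adj a b × ¬ (a ≡ x × b ≡ y) × ¬ (a ≡ y × b ≡ x)

  -- A simple path from `x` to `y` that avoids the edge between them has at least two further
  -- vertices, and the edge closes it into a cycle.
  edge-is-cut : Acyclic G → ∀ {x y} → Adj x y → ¬ Star (Avoiding x y) x y
  edge-is-cut acyclic {x} {y} xy s with simple-path s
  ... | []             , []             , _ = loopless refl xy
  ... | (_ ∷ [])       , ((_ , ¬xy , _) ∷ []) , _ = ¬xy (refl , refl)
  ... | vs@(_ ∷ _ ∷ _) , p              , u =
    acyclic x vs (s≤s (s≤s z≤n) , u , close-path proj₁ p (adj-sym xy))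

  module _ (tree : IsTree G) (root : Vertex) where
    private
      -- Walks of length exactly `k` to the root. Below, `depth` is thus the distance to the root
      -- and `parent` the first step of a chosen shortest walk.
      Reach : ℕ → Vertex → Set
      Reach zero    u = u ≡ root
      Reach (suc k) u = ∃[ p ] Adj u p × Reach k p

      reach? : ∀ k u → Dec (Reach k u)
      reach? zero    u = u ≟ᵛ root
      reach? (suc k) u = any-vertex? λ p → adj? u p ×-dec reach? k p

      star⇒reach : ∀ {u} → Star Adj u root → ∃[ k ] Reach k u
      star⇒reach ε = zero , refl
      star⇒reach (a ◅ s) with star⇒reach s
      ... | k , r = suc k , _ , a , r

      shortest : ∀ u → ∃[ m ] Reach m u × (∀ j → Reach j u → m ≤ j)
      shortest u with star⇒reach (proj₁ tree u root)
      ... | k , r = least (λ k → reach? k u) k r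

      depth : Vertex → ℕ
      depth u = proj₁ (shortest u)

      head : ∀ {u} m → Reach m u → Maybe Vertex
      head zero    _       = nothing
      head (suc _) (p , _) = just p

      parent : Vertex → Maybe Vertex
      parent u = head (depth u) (proj₁ (proj₂ (shortest u)))

      parent-root : parent root ≡ nothing
      parent-root with shortest root
      ... | zero  , _ , _   = refl
      ... | suc m , _ , min = contradiction (min 0 refl) λ ()

      parent-nothing : ∀ {u} → parent u ≡ nothing → u ≡ root
      parent-nothing {u} eq with shortest u
      ... | zero , r , _ = r

      parent-adj : ∀ {u p} → parent u ≡ just p → Adj u p
      parent-adj {u} eq with shortest u
      parent-adj {u} refl | suc m , (p , a , _) , _ = a

      parent-depth : ∀ {u p} → parent u ≡ just p → depth p < depth u
      parent-depth {u} eq with shortest u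
      parent-depth {u} refl | suc m , (p , _ , r) , _ = s≤s (proj₂ (proj₂ (shortest p)) m r)

      -- If neither end were the parent of the other, the ascents from both ends to the root would
      -- avoid this edge and together join its ends, against `edge-is-cut`.
      adj-parent : ∀ {u v} → Adj u v → parent u ≡ just v ⊎ parent v ≡ just u
      adj-parent {u} {v} uv with ≡-dec _≟ᵛ_ (parent u) (just v) | ≡-dec _≟ᵛ_ (parent v) (just u)
      ... | yes p | _     = inj₁ p
      ... | no  _ | yes q = inj₂ q
      ... | no ¬p | no ¬q =
        contradiction (to-root u (<-wellFounded _) ◅◅ reverse avoiding-sym (to-root v (<-wellFounded _)))
                      (edge-is-cut (proj₂ tree) uv)
        where
          avoiding-sym : ∀ {a b} → Avoiding u v a b → Avoiding u v b a
          avoiding-sym (ab , ¬1 , ¬2) = adj-sym ab , (λ (p , q) → ¬2 (q , p)) , (λ (p , q) → ¬1 (q , p))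

          to-root : ∀ w → Acc _<_ (depth w) → Star (Avoiding u v) w root
          to-root w (acc rec) with parent w in eq
          ... | nothing = subst (λ r → Star (Avoiding u v) w r) (parent-nothing eq) ε
          ... | just p  = ( parent-adj eq , (λ { (refl , refl) → ¬p eq }) , (λ { (refl , refl) → ¬q eq }))
                          ◅ to-root p (rec (parent-depth eq))

    rooting : Rooting Adj root
    rooting = record
      { parent         = parent
      ; depth          = depth
      ; parent-root    = parent-root
      ; parent-nothing = parent-nothing
      ; parent-adj     = parent-adj
      ; parent-depth   = parent-depth
      ; adj-parent     = adj-parent
      }

-- Ancestors in a rooted tree

module Descent {V : Set} {Adj : Rel V 0ℓ} {root : V} (rooting : Rooting Adj root)
               (_≟_ : ∀ (u v : V) → Dec (u ≡ v)) where
  open Rooting rooting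

  infix 4 _≼_ _≼ₘ_

  -- `u ≼ w` means that `u` lies on the path from `w` up to the root, in other words that `w` is in
  -- the subtree hanging at `u`.
  data _≼_ (u : V) : V → Set where
    self : u ≼ u
    up   : ∀ {w p} → parent w ≡ just p → u ≼ p → u ≼ w

  -- nothing stands for a vertex outside the tree, above the root.
  _≼ₘ_ : V → Maybe V → Set
  u ≼ₘ nothing = ⊥
  u ≼ₘ just w  = u ≼ w

  ≼-depth : ∀ {u w} → u ≼ w → depth u ≤ depth w
  ≼-depth self      = ≤-refl
  ≼-depth (up eq s) = ≤-trans (≼-depth s) (<⇒≤ (parent-depth eq))

  ≼-up : ∀ {u w} → u ≢ w → u ≼ w → u ≼ₘ parent w
  ≼-up u≢w self      = contradiction refl u≢w
  ≼-up u≢w (up eq s) rewrite eq = s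

  ≼-down : ∀ {u w} → u ≼ₘ parent w → u ≼ w
  ≼-down {u} {w} s with parent w in eq
  ... | just p = up eq s

  ⋠-parent : ∀ {u} → ¬ u ≼ₘ parent u
  ⋠-parent {u} s with parent u in eq
  ... | just p = <⇒≱ (parent-depth eq) (≼-depth s)

  root-≼ : ∀ w → root ≼ w
  root-≼ w = go w (<-wellFounded _)
    where
      go : ∀ w → Acc _<_ (depth w) → root ≼ w
      go w (acc rec) with parent w in eq
      ... | nothing = subst (root ≼_) (sym (parent-nothing eq)) self
      ... | just p  = up eq (go p (rec (parent-depth eq)))

  _≼?_ : ∀ u w → Dec (u ≼ w)
  u ≼? w = go w (<-wellFounded _)
    where
      go : ∀ w → Acc _<_ (depth w) → Dec (u ≼ w)
      go w (acc rec) with u ≟ w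
      ... | yes refl = yes self
      ... | no  u≢w with parent w in eq
      ...   | nothing = no λ s → subst (u ≼ₘ_) eq (≼-up u≢w s)
      ...   | just p  = map′ (up eq) (λ s → subst (u ≼ₘ_) eq (≼-up u≢w s)) (go p (rec (parent-depth eq)))

  _≼ₘ?_ : ∀ u w → Dec (u ≼ₘ w)
  u ≼ₘ? nothing = no λ ()
  u ≼ₘ? just w  = u ≼? w

  child-towards : ∀ {x w} → x ≼ w → x ≢ w → ∃[ u ] parent u ≡ just x × u ≼ w
  child-towards self x≢w = contradiction refl x≢w
  child-towards {x} {w} (up {p = p} eq s) x≢w with x ≟ p
  ... | yes refl = w , eq , self
  ... | no  x≢p with child-towards s x≢p
  ...   | u , pu , u≼p = u , pu , up eq u≼p

  -- Ascending from `w`, once one of the two siblings is met, the other would have to lie at or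
  -- above the common parent, which `⋠-parent` forbids.
  child-unique : ∀ {u u′ w} → parent u ≡ parent u′ → u ≼ w → u′ ≼ w → u ≡ u′
  child-unique {u} {u′} {w} eq s s′ with u ≟ w | u′ ≟ w
  ... | yes refl | yes refl = refl
  ... | yes refl | no  ≢u   = contradiction (subst (u′ ≼ₘ_) eq (≼-up ≢u s′)) ⋠-parent
  ... | no  ≢u   | yes refl = contradiction (subst (u ≼ₘ_) (sym eq) (≼-up ≢u s)) ⋠-parent
  child-unique eq self        s′ | no ≢u | _ = contradiction refl ≢u
  child-unique eq (up _  _)   self        | _ | no ≢u′ = contradiction refl ≢u′
  child-unique eq (up pw s)   (up pw′ s′) | no _ | no _ =
    child-unique eq s (subst (_ ≼_) (just-injective (trans (sym pw′) pw)) s′)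

-- Which vertex an edge keeps in its slot

module Edges {V W : Set} {Adj : Rel V 0ℓ} {root : V} (rooting : Rooting Adj root)
             (_≟_ : ∀ (u v : V) → Dec (u ≡ v)) (hub : W) where
  open Rooting rooting
  open Descent rooting _≟_

  above : Maybe V → V ⊎ W
  above = maybe′ inj₁ (inj₂ hub)

  -- The endpoint farther from the walker of the edge between u and its parent.
  edgeOccupant : V → Maybe V → V ⊎ W
  edgeOccupant u l = if does (u ≼ₘ? l) then above (parent u) else inj₁ u

  edgeOccupant-below : ∀ {u l} → u ≼ₘ l → edgeOccupant u l ≡ above (parent u)
  edgeOccupant-below {u} {l} s rewrite dec-true (u ≼ₘ? l) s = refl

  edgeOccupant-beside : ∀ {u l} → ¬ u ≼ₘ l → edgeOccupant u l ≡ inj₁ u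
  edgeOccupant-beside {u} {l} ¬s rewrite dec-false (u ≼ₘ? l) ¬s = refl

  edgeOccupant-cong : ∀ {u l l′} → (u ≼ₘ l → u ≼ₘ l′) → (u ≼ₘ l′ → u ≼ₘ l) →
                      edgeOccupant u l ≡ edgeOccupant u l′
  edgeOccupant-cong {u} {l} {l′} f g with u ≼ₘ? l
  ... | yes s = sym (edgeOccupant-below (f s))
  ... | no ¬s = sym (edgeOccupant-beside (¬s ∘ g))

  above-injective : ∀ {x y} → above x ≡ above y → x ≡ y
  above-injective {just _}  {just _}  refl = refl
  above-injective {nothing} {nothing} _    = refl

  above-≼ : ∀ {u u′ w} → u ≼ w → above (parent u) ≡ inj₁ u′ → u′ ≼ w
  above-≼ {u} s eq with parent u in pu
  above-≼ {u} s refl | just p = ≼-trans (up pu self) s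
    where
      ≼-trans : ∀ {a b c} → a ≼ b → b ≼ c → a ≼ c
      ≼-trans s self      = s
      ≼-trans s (up eq t) = up eq (≼-trans s t)

  -- Edges above the walker are occupied by ancestors of the walker or by the hub, the other edges
  -- by non-ancestors, so the two sorts never collide. Among edges above the walker `child-unique`
  -- decides.
  edgeOccupant-injective : ∀ {u u′ l} → edgeOccupant u l ≡ edgeOccupant u′ l → u ≡ u′
  edgeOccupant-injective {u} {u′} {nothing} eq = inj₁-injective eq
  edgeOccupant-injective {u} {u′} {just w} eq with u ≼? w | u′ ≼? w
  ... | yes s | yes s′ = child-unique (above-injective eq) s s′
  ... | yes s | no ¬s′ = contradiction (above-≼ s eq) ¬s′
  ... | no ¬s | yes s′ = contradiction (above-≼ s′ (sym eq)) ¬s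
  ... | no  _ | no  _  = inj₁-injective eq

  -- A vertex off the walker's path to the root occupies its own parent edge; one on that path
  -- occupies the edge to its child in the direction of the walker.
  edgeOccupant-tree : ∀ {z} l → l ≢ just z → ∃[ u ] edgeOccupant u l ≡ inj₁ z
  edgeOccupant-tree {z} nothing  l≢z = z , refl
  edgeOccupant-tree {z} (just w) l≢z with z ≼? w
  ... | no ¬s = z , edgeOccupant-beside ¬s
  ... | yes s with child-towards s (l≢z ∘ cong just ∘ sym)
  ...   | u , pu , u≼w = u , trans (edgeOccupant-below u≼w) (cong above pu)

  edgeOccupant-≢walker : ∀ {u w} → edgeOccupant u (just w) ≢ inj₁ w
  edgeOccupant-≢walker {u} {w} eq with u ≼? w
  ... | no ¬s = ¬s (subst (u ≼_) (inj₁-injective eq) self)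
  ... | yes s with parent u in pu
  edgeOccupant-≢walker {u} refl | yes s | just p = ⋠-parent (subst (u ≼ₘ_) (sym pu) s)

  edgeOccupant-root : ∀ w → edgeOccupant root (just w) ≡ inj₂ hub
  edgeOccupant-root w = trans (edgeOccupant-below (root-≼ w)) (cong above parent-root)

  edgeOccupant-hub : ∀ {u l c} → edgeOccupant u l ≡ inj₂ c → l ≢ nothing × c ≡ hub
  edgeOccupant-hub {u} {just w} eq with u ≼? w
  ... | yes s with parent u
  edgeOccupant-hub {u} {just w} refl | yes s | nothing = (λ ()) , refl

-- The motion of the walker

leaves : ∀ {X : Set} {P : X → Set} → (∀ x → Dec (P x)) → (f : X → X) →
         ∀ l {x} → P x → ¬ P (iterate f x l) →
         ∃[ t ] P (iterate f x t) × ¬ P (f (iterate f x t))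
leaves P? f zero    px ¬p = contradiction px ¬p
leaves P? f (suc l) {x} px ¬p with P? (f x)
... | no  ¬pfx = zero , px , ¬pfx
... | yes pfx with leaves P? f l pfx ¬p
...   | t , q = suc t , q

cyclicPred : ∀ {n} → Fin n → Fin n
cyclicPred {suc n} zero    = fromℕ n
cyclicPred         (suc i) = inject₁ i

cyclicPred-injective : ∀ {n} → Injective _≡_ _≡_ (cyclicPred {n})
cyclicPred-injective {x = zero}  {zero}  eq = refl
cyclicPred-injective {x = zero}  {suc j} eq = contradiction eq fromℕ≢inject₁
cyclicPred-injective {x = suc i} {zero}  eq = contradiction (sym eq) fromℕ≢inject₁
cyclicPred-injective {x = suc i} {suc j} eq = cong suc (inject₁-injective eq)

-- One descends from `i` to `zero`, wraps to the top and descends again to `j`; `up-to` carries out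
-- the last descent by induction on the distance from the top.
cyclicPred-transitive : ∀ {n} {P : Fin n → Set} → (∀ i → P i → P (cyclicPred i)) →
                        ∀ {i} → P i → ∀ j → P j
cyclicPred-transitive {suc n} {P} next p = λ j → up-to (n ∸ toℕ j) j (m+[n∸m]≡n (≤-pred (toℕ<n j)))
  where
    down : ∀ k i → toℕ i ≡ k → P i → P zero
    down zero    zero    _  p = p
    down (suc k) (suc i) eq p = down k (inject₁ i) (trans (toℕ-inject₁ i) (suc-injective eq)) (next _ p)

    up-to : ∀ d j → toℕ j + d ≡ n → P j
    up-to zero j eq =
      subst P (toℕ-injective (trans (toℕ-fromℕ n) (trans (sym eq) (+-identityʳ _)))) (next zero (down _ _ refl p))
    up-to (suc d) j eq = subst P (toℕ-injective j-pred) (next _ (up-to d j⁺ (trans (cong (_+ d) (toℕ-fromℕ< j<n)) (trans (sym (+-suc _ d)) eq))))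
      where
        j<n : suc (toℕ j) < suc n
        j<n = s≤s (subst (suc (toℕ j) ≤_) eq (subst (_≤ toℕ j + suc d) (+-comm (toℕ j) 1) (+-monoʳ-≤ (toℕ j) (s≤s z≤n))))
        j⁺ : Fin (suc n)
        j⁺ = fromℕ< j<n
        j-pred : toℕ (cyclicPred j⁺) ≡ toℕ j
        j-pred = trans (toℕ-inject₁ _) (toℕ-fromℕ< (≤-pred j<n))

countBelow : (ℕ → Bool) → ℕ → ℕ
countBelow p zero    = zero
countBelow p (suc k) = if p k then suc (countBelow p k) else countBelow p k

-- A slot is one of the M places occupied by the vertices other than the walker;
-- the kind of a slot is just u for the edge from u towards the root, and
-- nothing for a slot of the clique.
record Layout {m n : ℕ} (T : Graph m) (K : Graph n) (v₁ : Graph.Vertex T) (v₂ : Graph.Vertex K)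
              (M : ℕ) : Set where
  field
    kind           : ℕ → Maybe (Graph.Vertex T)
    kind-injective : ∀ {k k′ u} → k < M → k′ < M → kind k ≡ just u → kind k′ ≡ just u → k ≡ k′
    slot           : ∀ u → ∃[ k ] k < M × kind k ≡ just u
    -- The bridge counts as the parent edge of the root `v₁`, and every round begins at it.
    kind-zero      : kind 0 ≡ just v₁

    -- One clique vertex is in no clique slot: the walker itself, or `v₂` in the bridge slot when
    -- the walker is in the tree.
    count-total    : suc (countBelow (is-nothing ∘ kind) M) ≡ n
    order           : Fin n → Graph.Vertex K
    order-injective : Injective _≡_ _≡_ order
    j₂              : Fin n
    order-j₂        : order j₂ ≡ v₂

module Model {m n : ℕ} {T : Graph m} {K : Graph n} {v₁ : Graph.Vertex T} {v₂ : Graph.Vertex K}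
             (rooting : Rooting (Graph.Adj T) v₁) {M : ℕ} (layout : Layout T K v₁ v₂ M) where
  open Graph T using (_≟ᵛ_) renaming (Vertex to VT; finite to finiteT)
  open Rooting rooting public
  open Descent rooting _≟ᵛ_ public
  open Layout layout public

  -- inj₁ w: the walker is at the tree vertex w.  inj₂ j: the walker is in the
  -- clique, and clique j is the clique vertex it occupied when the round began.
  Place : Set
  Place = VT ⊎ Fin n

  _≟ᵖ_ : (y z : Place) → Dec (y ≡ z)
  _≟ᵖ_ = ⊎-≡-dec _≟ᵛ_ _≟ᶠ_

  -- Above the root lies the clique end of the bridge. As the bridge has slot 0, `v₂` is there also
  -- the vertex occupied at the beginning of the round, which is index `j₂`.
  parentPlace : VT → Place
  parentPlace u = maybe′ inj₁ (inj₂ j₂) (parent u)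

  parentPlace≢ : ∀ u → parentPlace u ≢ inj₁ u
  parentPlace≢ u eq with parent u in pu
  parentPlace≢ u refl | just p = <-irrefl refl (parent-depth pu)

  location : Place → Maybe VT
  location (inj₁ w) = just w
  location (inj₂ _) = nothing

  location-parentPlace : ∀ u → location (parentPlace u) ≡ parent u
  location-parentPlace u with parent u
  ... | just _  = refl
  ... | nothing = refl

  infix 4 _⊒_
  -- The place lies beyond the parent edge of `u`, as seen from the clique.
  _⊒_ : Place → VT → Set
  y ⊒ u = u ≼ₘ location y

  parentPlace⋣ : ∀ {u} → ¬ parentPlace u ⊒ u
  parentPlace⋣ {u} s = ⋠-parent (subst (u ≼ₘ_) (location-parentPlace u) s)

  cross : VT → Place → Place
  cross u y = if does (y ≟ᵖ inj₁ u) then parentPlace u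
              else if does (y ≟ᵖ parentPlace u) then inj₁ u else y

  cross-child : ∀ u → cross u (inj₁ u) ≡ parentPlace u
  cross-child u rewrite dec-true (inj₁ u ≟ᵖ inj₁ u) refl = refl

  cross-parent : ∀ u → cross u (parentPlace u) ≡ inj₁ u
  cross-parent u
    rewrite dec-false (parentPlace u ≟ᵖ inj₁ u) (parentPlace≢ u)
          | dec-true (parentPlace u ≟ᵖ parentPlace u) refl = refl

  cross-other : ∀ {u y} → y ≢ inj₁ u → y ≢ parentPlace u → cross u y ≡ y
  cross-other {u} {y} y≢u y≢p
    rewrite dec-false (y ≟ᵖ inj₁ u) y≢u | dec-false (y ≟ᵖ parentPlace u) y≢p = refl

  data CrossView (u : VT) : Place → Set where
    atChild   : CrossView u (inj₁ u)
    atParent  : CrossView u (parentPlace u)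
    elsewhere : ∀ {y} → y ≢ inj₁ u → y ≢ parentPlace u → CrossView u y

  crossView : ∀ u y → CrossView u y
  crossView u y with y ≟ᵖ inj₁ u
  ... | yes refl = atChild
  ... | no  y≢u with y ≟ᵖ parentPlace u
  ...   | yes refl = atParent
  ...   | no  y≢p  = elsewhere y≢u y≢p

  cross-involutive : ∀ u y → cross u (cross u y) ≡ y
  cross-involutive u y with crossView u y
  ... | atChild         = trans (cong (cross u) (cross-child u)) (cross-parent u)
  ... | atParent        = trans (cong (cross u) (cross-parent u)) (cross-child u)
  ... | elsewhere y≢u y≢p = trans (cong (cross u) (cross-other y≢u y≢p)) (cross-other y≢u y≢p)

  ⊒-child⇒parent : ∀ {u u′} → u ≢ u′ → inj₁ u′ ⊒ u → parentPlace u′ ⊒ u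
  ⊒-child⇒parent {u} {u′} u≢u′ s = subst (u ≼ₘ_) (sym (location-parentPlace u′)) (≼-up u≢u′ s)

  ⊒-parent⇒child : ∀ {u u′} → parentPlace u′ ⊒ u → inj₁ u′ ⊒ u
  ⊒-parent⇒child {u} {u′} s = ≼-down (subst (u ≼ₘ_) (location-parentPlace u′) s)

  -- The two ends of another edge are a vertex and its parent, and these lie on the same side of the
  -- edge of `u`.
  cross-⊒ : ∀ {u u′} y → u ≢ u′ → y ⊒ u → cross u′ y ⊒ u
  cross-⊒ {u} {u′} y u≢u′ s with crossView u′ y
  ... | atChild         = subst (_⊒ u) (sym (cross-child u′)) (⊒-child⇒parent u≢u′ s)
  ... | atParent        = subst (_⊒ u) (sym (cross-parent u′)) (⊒-parent⇒child s)
  ... | elsewhere y≢u y≢p = subst (_⊒ u) (sym (cross-other y≢u y≢p)) s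

  cross-⊒⁻ : ∀ {u u′} y → u ≢ u′ → cross u′ y ⊒ u → y ⊒ u
  cross-⊒⁻ {u} {u′} y u≢u′ s = subst (_⊒ u) (cross-involutive u′ y) (cross-⊒ (cross u′ y) u≢u′ s)

  -- At a clique slot a walker in the clique does change vertex, but its place records where it
  -- began the round and stays the same.
  move : ℕ → Place → Place
  move τ y = maybe′ (λ u → cross u y) y (kind τ)

  move-edge : ∀ {τ u} → kind τ ≡ just u → ∀ y → move τ y ≡ cross u y
  move-edge eq y rewrite eq = refl

  move-clique : ∀ {τ} → kind τ ≡ nothing → ∀ y → move τ y ≡ y
  move-clique eq y rewrite eq = refl

  move-involutive : ∀ τ y → move τ (move τ y) ≡ y
  move-involutive τ y with kind τ
  ... | just u  = cross-involutive u y
  ... | nothing = refl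

  -- After a full round every clique vertex has moved on to the next clique slot.
  wrap : Place → Place
  wrap (inj₁ w) = inj₁ w
  wrap (inj₂ j) = inj₂ (cyclicPred j)

  wrap-injective : Injective _≡_ _≡_ wrap
  wrap-injective {inj₁ _} {inj₁ _} eq = cong inj₁ (inj₁-injective eq)
  wrap-injective {inj₂ _} {inj₂ _} eq = cong inj₂ (cyclicPred-injective (inj₂-injective eq))

  location-wrap : ∀ y → location (wrap y) ≡ location y
  location-wrap (inj₁ _) = refl
  location-wrap (inj₂ _) = refl

  0<M : 0 < M
  0<M = ≤-<-trans z≤n (proj₁ (proj₂ (slot v₁)))

  Config : Set
  Config = Place × Fin M

  start : Fin M
  start = fromℕ< 0<M

  advance : Config → Config
  advance (y , τ) with suc (toℕ τ) <? M
  ... | yes τ+1<M = y , fromℕ< τ+1<M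
  ... | no  _     = wrap y , start

  advance-injective : Injective _≡_ _≡_ advance
  advance-injective {y , τ} {z , υ} eq with suc (toℕ τ) <? M | suc (toℕ υ) <? M
  ... | yes p | yes q = cong₂ _,_ (cong proj₁ eq)
    (toℕ-injective (suc-injective (fromℕ<-injective _ _ p q (cong proj₂ eq))))
  ... | yes p | no  _ = contradiction (fromℕ<-injective _ _ p 0<M (cong proj₂ eq)) λ ()
  ... | no  _ | yes q = contradiction (fromℕ<-injective _ _ 0<M q (cong proj₂ eq)) λ ()
  ... | no ¬p | no ¬q = cong₂ _,_ (wrap-injective (cong proj₁ eq))
    (toℕ-injective (suc-injective (trans (≤-antisym (toℕ<n τ) (≮⇒≥ ¬p)) (≤-antisym (≮⇒≥ ¬q) (toℕ<n υ)))))

  location-advance : ∀ y τ → location (proj₁ (advance (y , τ))) ≡ location y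
  location-advance y τ with suc (toℕ τ) <? M
  ... | yes _ = refl
  ... | no  _ = location-wrap y

  step : Config → Config
  step (y , τ) = advance (move (toℕ τ) y , τ)

  step-injective : Injective _≡_ _≡_ step
  step-injective {y , τ} {z , υ} eq with advance-injective eq
  ... | eq′ with cong proj₂ eq′
  ...   | refl = cong (_, τ) (begin
    y                           ≡⟨ move-involutive (toℕ τ) y ⟨
    move (toℕ τ) (move (toℕ τ) y) ≡⟨ cong (move (toℕ τ)) (cong proj₁ eq′) ⟩
    move (toℕ τ) (move (toℕ τ) z) ≡⟨ move-involutive (toℕ τ) z ⟩
    z                           ∎)
    where open ≡-Reasoning

  Config↔ : Config ↔ Fin ((m + n) * M)
  Config↔ = ↔-sym *↔× ↔-∘ ((↔-sym +↔⊎ ↔-∘ (finiteT ⊎-↔ ↔-id (Fin n))) ×-↔ ↔-id (Fin M))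

  -- No other slot changes the side of the edge of `u`, by `cross-⊒`, and `advance` preserves the
  -- location.
  exit-edge : ∀ {u} c → proj₁ c ⊒ u → ¬ proj₁ (step c) ⊒ u →
              kind (toℕ (proj₂ c)) ≡ just u × proj₁ c ≡ inj₁ u
  exit-edge {u} (y , τ) s ¬s = go (subst (λ l → ¬ u ≼ₘ l) (location-advance (move (toℕ τ) y) τ) ¬s)
    where
      go : ¬ move (toℕ τ) y ⊒ u → kind (toℕ τ) ≡ just u × y ≡ inj₁ u
      go ¬s with kind (toℕ τ)
      ... | nothing = contradiction s ¬s
      ... | just u′ with u ≟ᵛ u′
      ...   | no u≢u′ = contradiction (cross-⊒ y u≢u′ s) ¬s
      ...   | yes refl with crossView u y
      ...     | atChild         = refl , refl
      ...     | atParent        = contradiction s parentPlace⋣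
      ...     | elsewhere y≢u y≢p = contradiction (subst (_⊒ u) (sym (cross-other y≢u y≢p)) s) ¬s

  entry-edge : ∀ {u} c → ¬ proj₁ c ⊒ u → proj₁ (step c) ⊒ u →
               kind (toℕ (proj₂ c)) ≡ just u × proj₁ c ≡ parentPlace u
  entry-edge {u} (y , τ) ¬s s = go (subst (u ≼ₘ_) (location-advance (move (toℕ τ) y) τ) s)
    where
      go : move (toℕ τ) y ⊒ u → kind (toℕ τ) ≡ just u × y ≡ parentPlace u
      go s with kind (toℕ τ)
      ... | nothing = contradiction s ¬s
      ... | just u′ with u ≟ᵛ u′
      ...   | no u≢u′ = contradiction (cross-⊒⁻ y u≢u′ s) ¬s
      ...   | yes refl with crossView u y
      ...     | atChild         = contradiction self ¬s
      ...     | atParent        = refl , refl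
      ...     | elsewhere y≢u y≢p = contradiction (subst (_⊒ u) (cross-other y≢u y≢p) s) ¬s

  -- All configurations lie on one orbit

  module _ (c₀ : Config) where
    open FiniteOrbit Config↔ step step-injective c₀

    private
      visited-iterate : ∀ {c} → Visited c → ∀ k → Visited (iterate step c k)
      visited-iterate (i , refl) k = i + k , iterate-+ step c₀ i k

      visited-again : ∀ {c d} → Visited c → Visited d → ∃[ l ] iterate step d l ≡ c
      visited-again vc (k , refl) = visited-after vc k

      same-slot : ∀ {u τ υ} → kind (toℕ τ) ≡ just u → kind (toℕ υ) ≡ just u → τ ≡ υ
      same-slot {τ = τ} {υ} p q = toℕ-injective (kind-injective (toℕ<n τ) (toℕ<n υ) p q)

      step-edge-location : ∀ {u y τ} → kind (toℕ τ) ≡ just u →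
                           location (proj₁ (step (y , τ))) ≡ location (cross u y)
      step-edge-location {y = y} {τ} k =
        trans (location-advance (move (toℕ τ) y) τ) (cong location (move-edge k y))

      -- The walker is back above the edge in a later period, and the only way out
      -- of the subtree below an edge is across that edge.
      visited-child : ∀ {u τ} → kind (toℕ τ) ≡ just u → Visited (parentPlace u , τ) → Visited (inj₁ u , τ)
      visited-child {u} {τ} k v
        with l , eq ← visited-again v (visited-step v)
        with t , below , above ← leaves {P = λ c → proj₁ c ⊒ u} (λ c → u ≼ₘ? location (proj₁ c)) step l
               (subst (u ≼ₘ_) (sym (trans (step-edge-location {τ = τ} k) (cong location (cross-parent u)))) self)
               (subst (λ c → ¬ proj₁ c ⊒ u) (sym eq) parentPlace⋣)
        with iterate step (step (parentPlace u , τ)) t | visited-iterate (visited-step v) t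
      ... | c@(_ , υ) | vc with exit-edge c below above
      ...   | k′ , refl with same-slot {τ = τ} {υ} k k′
      ...     | refl = vc

      -- The mirror image of `visited-child`: the walker is back in the subtree a period later, and
      -- the only way in is across the same edge.
      visited-parent : ∀ {u τ} → kind (toℕ τ) ≡ just u → Visited (inj₁ u , τ) → Visited (parentPlace u , τ)
      visited-parent {u} {τ} k v
        with l , eq ← visited-again v (visited-step v)
        with t , above , below ← leaves {P = λ c → ¬ proj₁ c ⊒ u} (λ c → ¬? (u ≼ₘ? location (proj₁ c))) step l
               (subst (λ l → ¬ u ≼ₘ l) (sym (trans (step-edge-location {τ = τ} k) (cong location (cross-child u)))) parentPlace⋣)
               (λ ¬s → subst (λ c → ¬ proj₁ c ⊒ u) eq ¬s self)
        with iterate step (step (inj₁ u , τ)) t | visited-iterate (visited-step v) t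
      ... | c@(_ , υ) | vc with entry-edge c above (decidable-stable (u ≼ₘ? _) below)
      ...   | k′ , refl with same-slot {τ = τ} {υ} k k′
      ...     | refl = vc

      visited-move : ∀ {y τ} → Visited (y , τ) → Visited (move (toℕ τ) y , τ)
      visited-move {y} {τ} v with kind (toℕ τ) in k
      ... | nothing = v
      ... | just u with crossView u y
      ...   | atChild         = subst (λ z → Visited (z , τ)) (sym (cross-child u)) (visited-parent k v)
      ...   | atParent        = subst (λ z → Visited (z , τ)) (sym (cross-parent u)) (visited-child k v)
      ...   | elsewhere y≢u y≢p = subst (λ z → Visited (z , τ)) (sym (cross-other y≢u y≢p)) v

      -- The place on the other side, `move (toℕ τ) y`, is visited at the same slot, and since
      -- `move` is an involution its step is the advance of `y`. So the walker may be thought to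
      -- wait without crossing.
      visited-advance : ∀ {y τ} → Visited (y , τ) → Visited (advance (y , τ))
      visited-advance {y} {τ} v =
        subst (λ z → Visited (advance (z , τ))) (move-involutive (toℕ τ) y) (visited-step (visited-move v))

      visited-suc : ∀ {y τ} → Visited (y , τ) → (<M : suc (toℕ τ) < M) → Visited (y , fromℕ< <M)
      visited-suc {y} {τ} v <M with suc (toℕ τ) <? M | visited-advance v
      ... | yes p | v′ = v′
      ... | no ¬p | _  = contradiction <M ¬p

      visited-from-start : ∀ {y} → Visited (y , start) → ∀ τ → Visited (y , τ)
      visited-from-start {y} v τ =
        subst (λ υ → Visited (y , υ)) (toℕ-injective (toℕ-fromℕ< (toℕ<n τ))) (go (toℕ τ) (toℕ<n τ))
        where
          go : ∀ k (<M : k < M) → Visited (y , fromℕ< <M)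
          go zero    <M = subst (λ υ → Visited (y , υ)) (toℕ-injective (trans (toℕ-fromℕ< 0<M) (sym (toℕ-fromℕ< <M)))) v
          go (suc k) <M = subst (λ υ → Visited (y , υ))
            (toℕ-injective (trans (toℕ-fromℕ< (subst (λ j → suc j < M) (sym k≡) <M)) (trans (cong suc k≡) (sym (toℕ-fromℕ< <M)))))
            (visited-suc (go k k<M) (subst (λ j → suc j < M) (sym k≡) <M))
            where
              k<M = <-trans (n<1+n k) <M
              k≡ : toℕ (fromℕ< k<M) ≡ k
              k≡ = toℕ-fromℕ< k<M

      visited-wrap : ∀ {y τ} → Visited (y , τ) → Visited (wrap y , start)
      visited-wrap {y} {τ} v = go (M ∸ toℕ τ) τ ≤-refl v
        where
          go : ∀ d τ → M ∸ toℕ τ ≤ d → Visited (y , τ) → Visited (wrap y , start)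
          go zero    τ le v = contradiction (m∸n≡0⇒m≤n (n≤0⇒n≡0 le)) (<⇒≱ (toℕ<n τ))
          go (suc d) τ le v with suc (toℕ τ) <? M | visited-advance v
          ... | no  _ | v′ = v′
          ... | yes p | v′ = go d (fromℕ< p)
            (≤-pred (≤-trans (subst (λ k → M ∸ k < M ∸ toℕ τ) (sym (toℕ-fromℕ< p)) (∸-monoʳ-< (n<1+n _) (<⇒≤ p))) le)) v′

      visited-always : ∀ {y τ} → Visited (y , τ) → ∀ υ → Visited (wrap y , υ)
      visited-always v = visited-from-start (visited-wrap v)

      clique-visited : ∀ {j τ} → Visited (inj₂ j , τ) → ∀ i υ → Visited (inj₂ i , υ)
      clique-visited v i υ =
        visited-from-start (cyclicPred-transitive {P = λ i → Visited (inj₂ i , start)}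
                                                  (λ _ v → visited-always v start) (visited-always v start) i) υ

      slotᶠ : ∀ u → ∃[ τ ] kind (toℕ {M} τ) ≡ just u
      slotᶠ u with slot u
      ... | k , <M , eq = fromℕ< <M , trans (cong kind (toℕ-fromℕ< <M)) eq

      -- Waiting at `u` for the slot of its parent edge puts the parent on the orbit; depth
      -- decreases until the bridge leads into the clique.
      climb : ∀ u → Acc _<_ (depth u) → ∀ {τ} → Visited (inj₁ u , τ) → ∃[ j ] ∃[ υ ] Visited (inj₂ j , υ)
      climb u (acc rec) v with slotᶠ u
      ... | υ , k with parent u in eq | visited-parent k (visited-always v υ)
      ...   | nothing | v′ = _ , _ , v′
      ...   | just p  | v′ = climb p (rec (parent-depth eq)) v′

      clique-reached : ∀ {c} → Visited c → ∃[ j ] ∃[ υ ] Visited (inj₂ j , υ)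
      clique-reached {inj₁ u , _} v = climb u (<-wellFounded _) v
      clique-reached {inj₂ j , _} v = _ , _ , v

      all-clique : ∀ j τ → Visited (inj₂ j , τ)
      all-clique with clique-reached (zero , refl)
      ... | _ , _ , v = clique-visited v

      -- Induction on depth, starting from the clique: once the parent is visited at all times, the
      -- edge slot gives the child, and waiting gives all its times.
      all-tree : ∀ u → Acc _<_ (depth u) → ∀ τ → Visited (inj₁ u , τ)
      all-tree u (acc rec) τ with slotᶠ u
      ... | υ , k = visited-always (visited-child k above) τ
        where
          above : Visited (parentPlace u , υ)
          above with parent u in eq
          ... | nothing = all-clique j₂ υ
          ... | just p  = all-tree p (rec (parent-depth eq)) υ

    transitive : ∀ c → Visited c
    transitive (inj₁ u , τ) = all-tree u (<-wellFounded _) τ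
    transitive (inj₂ j , τ) = all-clique j τ

-- Residues and labels

module Residues (N : ℕ) .{{_ : NonZero N}} where

  %-+-congʳ : ∀ {a b} c → a % N ≡ b % N → (a + c) % N ≡ (b + c) % N
  %-+-congʳ {a} {b} c eq = begin
    (a + c) % N             ≡⟨ %-distribˡ-+ a c N ⟩
    (a % N + c % N) % N     ≡⟨ cong (λ r → (r + c % N) % N) eq ⟩
    (b % N + c % N) % N     ≡⟨ %-distribˡ-+ b c N ⟨
    (b + c) % N             ∎
    where open ≡-Reasoning

  private
    -- `c * N ∸ c` plays the part of the negative of `c` modulo `N`; the inequality makes the
    -- truncated subtraction exact.
    complement : ∀ c → c ≤ c * N
    complement c = subst (_≤ c * N) (*-identityʳ c) (*-monoʳ-≤ c (>-nonZero⁻¹ N))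

    undo : ∀ a c → (a + c + (c * N ∸ c)) % N ≡ a % N
    undo a c = begin
      (a + c + (c * N ∸ c)) % N   ≡⟨ cong (_% N) (+-assoc a c _) ⟩
      (a + (c + (c * N ∸ c))) % N ≡⟨ cong (λ k → (a + k) % N) (m+[n∸m]≡n (complement c)) ⟩
      (a + c * N) % N             ≡⟨ [m+kn]%n≡m%n a c N ⟩
      a % N                       ∎
      where open ≡-Reasoning

  %-+-cancelʳ : ∀ {a b} c → (a + c) % N ≡ (b + c) % N → a % N ≡ b % N
  %-+-cancelʳ {a} {b} c eq =
    trans (sym (undo a c)) (trans (%-+-congʳ {a + c} {b + c} (c * N ∸ c) eq) (undo b c))

  +-%-injective : ∀ a {h k} → h < N → k < N → (a + h) % N ≡ (a + k) % N → h ≡ k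
  +-%-injective a {h} {k} h<N k<N eq = begin
    h     ≡⟨ m<n⇒m%n≡m h<N ⟨
    h % N ≡⟨ %-+-cancelʳ {h} {k} a (subst₂ (λ x y → x % N ≡ y % N) (+-comm a h) (+-comm a k) eq) ⟩
    k % N ≡⟨ m<n⇒m%n≡m k<N ⟩
    k     ∎
    where open ≡-Reasoning

  toℕ-mod : ∀ x → toℕ (x mod N) ≡ x % N
  toℕ-mod x = toℕ-fromℕ< (m%n<n x N)

  mod-cong : ∀ {x y} → x % N ≡ y % N → x mod N ≡ y mod N
  mod-cong eq = fromℕ<-cong _ _ eq _ _

  mod-% : ∀ {x y} → x mod N ≡ y mod N → x % N ≡ y % N
  mod-% {x} {y} eq = trans (sym (toℕ-mod x)) (trans (cong toℕ eq) (toℕ-mod y))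

  toℕ-mod-id : ∀ (i : Fin N) → toℕ i mod N ≡ i
  toℕ-mod-id i = toℕ-injective (trans (toℕ-mod (toℕ i)) (m<n⇒m%n≡m (toℕ<n i)))

  abstract
    offset : ∀ a (i : Fin N) → ∃[ h ] h < N × (a + h) mod N ≡ i
    offset a i = h % N , m%n<n h N , trans (mod-cong eq) (toℕ-mod-id i)
      where
        open ≡-Reasoning
        h : ℕ
        h = toℕ i + (a * N ∸ a)
        eq : (a + h % N) % N ≡ toℕ i % N
        eq = begin
          (a + h % N) % N             ≡⟨ cong (_% N) (+-comm a _) ⟩
          (h % N + a) % N             ≡⟨ %-+-congʳ {h % N} {h} a (m%n%n≡m%n h N) ⟩
          (h + a) % N                 ≡⟨ cong (_% N) (trans (+-assoc (toℕ i) _ a) (trans (cong (toℕ i +_) (+-comm _ a)) (sym (+-assoc (toℕ i) a _)))) ⟩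
          (toℕ i + a + (a * N ∸ a)) % N ≡⟨ undo (toℕ i) a ⟩
          toℕ i % N                   ∎

  next-mod : ∀ x → next (x mod N) ≡ suc x mod N
  next-mod x = mod-cong (begin
    suc (toℕ (x mod N)) % N ≡⟨ cong (λ r → suc r % N) (toℕ-mod x) ⟩
    suc (x % N) % N         ≡⟨ cong (_% N) (+-comm 1 (x % N)) ⟩
    (x % N + 1) % N         ≡⟨ %-+-congʳ {x % N} {x} 1 (m%n%n≡m%n x N) ⟩
    (x + 1) % N             ≡⟨ cong (_% N) (+-comm x 1) ⟩
    suc x % N               ∎)
    where open ≡-Reasoning

transpose-left : ∀ {N} (i j : Fin N) → Components.transpose i j i ≡ j
transpose-left i j rewrite dec-true (i ≟ᶠ i) refl = refl

transpose-right : ∀ {N} (i j : Fin N) → Components.transpose i j j ≡ i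
transpose-right i j with j ≟ᶠ i
... | yes j≡i = j≡i
... | no  _   rewrite dec-true (j ≟ᶠ j) refl = refl

transpose-fix : ∀ {N} {i j k : Fin N} → k ≢ i → k ≢ j → Components.transpose i j k ≡ k
transpose-fix {i = i} {j} {k} k≢i k≢j
  rewrite dec-false (k ≟ᶠ i) k≢i | dec-false (k ≟ᶠ j) k≢j = refl

-- One step of promotion, read off the labels

module Reading {N : ℕ} .{{_ : NonZero N}} (G : Graph N) where
  open Graph G
  open Residues N

  -- Labels are natural numbers read modulo `N`, so that a base and an offset can be added without a
  -- case distinction at the end of the range.
  occupant : State G → ℕ → Vertex
  occupant (σ , _) x = Inverse.from σ (x mod N)

  occupant-cong : ∀ s {x y} → x % N ≡ y % N → occupant s x ≡ occupant s y
  occupant-cong (σ , _) eq = cong (Inverse.from σ) (mod-cong eq)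

  occupant-≈ : ∀ {s t} → _≈ₛ_ G s t → ∀ x → occupant s x ≡ occupant t x
  occupant-≈ {σ , _} {τ , _} (eq , _) x = begin
    σ.from i                   ≡⟨ τ.strictlyInverseʳ _ ⟨
    τ.from (τ.to (σ.from i))   ≡⟨ cong τ.from (eq _) ⟨
    τ.from (σ.to (σ.from i))   ≡⟨ cong τ.from (σ.strictlyInverseˡ i) ⟩
    τ.from i                   ∎
    where
      open ≡-Reasoning
      module σ = Inverse σ
      module τ = Inverse τ
      i = x mod N

  ≈-from : ∀ {s t} → (∀ i → Inverse.from (proj₁ s) i ≡ Inverse.from (proj₁ t) i) →
           proj₂ s ≡ proj₂ t → _≈ₛ_ G s t
  ≈-from {σ , _} {τ , _} eq eq′ = (λ v → begin
    σ.to v                     ≡⟨ τ.strictlyInverseˡ _ ⟨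
    τ.to (τ.from (σ.to v))     ≡⟨ cong τ.to (eq _) ⟨
    τ.to (σ.from (σ.to v))     ≡⟨ cong τ.to (σ.strictlyInverseʳ v) ⟩
    τ.to v                     ∎) , eq′
    where
      open ≡-Reasoning
      module σ = Inverse σ
      module τ = Inverse τ

  TPro-pointer : ∀ s {x} → proj₂ s ≡ x mod N → proj₂ (TPro G s) ≡ suc x mod N
  TPro-pointer (σ , i) {x} refl with adj? (Inverse.from σ i) (Inverse.from σ (next i))
  ... | yes _ = next-mod x
  ... | no  _ = next-mod x

  TPro-adjacent : ∀ s {x} → proj₂ s ≡ x mod N → Adj (occupant s x) (occupant s (suc x)) →
                  ∀ y → occupant (TPro G s) y ≡ occupant s y
  TPro-adjacent (σ , i) {x} refl a y with adj? (Inverse.from σ i) (Inverse.from σ (next i))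
  ... | yes _ = refl
  ... | no ¬a = contradiction (subst (Adj _) (cong (Inverse.from σ) (sym (next-mod x))) a) ¬a

  -- Occupants come from the inverse labeling, and the inverse of `transpose i j` computes to
  -- `transpose j i`, hence the reversed arguments.
  TPro-nonadjacent : ∀ s {x} → proj₂ s ≡ x mod N → ¬ Adj (occupant s x) (occupant s (suc x)) →
                     ∀ y → occupant (TPro G s) y ≡
                           Inverse.from (proj₁ s) (Components.transpose (suc x mod N) (x mod N) (y mod N))
  TPro-nonadjacent (σ , i) {x} refl ¬a y with adj? (Inverse.from σ i) (Inverse.from σ (next i))
  ... | yes a = contradiction (subst (Adj _) (cong (Inverse.from σ) (next-mod x)) a) ¬a
  ... | no  _ = cong (λ j → Inverse.from σ (Components.transpose j i (y mod N))) (next-mod x)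

  module _ (s : State G) {x : ℕ} (pointer : proj₂ s ≡ x mod N)
           (¬a : ¬ Adj (occupant s x) (occupant s (suc x))) where

    TPro-swap-left : occupant (TPro G s) x ≡ occupant s (suc x)
    TPro-swap-left = trans (TPro-nonadjacent s pointer ¬a x) (cong (Inverse.from (proj₁ s)) (transpose-right (suc x mod N) (x mod N)))

    TPro-swap-right : occupant (TPro G s) (suc x) ≡ occupant s x
    TPro-swap-right = trans (TPro-nonadjacent s pointer ¬a (suc x)) (cong (Inverse.from (proj₁ s)) (transpose-left (suc x mod N) (x mod N)))

    TPro-swap-fix : ∀ {y} → y % N ≢ x % N → y % N ≢ suc x % N → occupant (TPro G s) y ≡ occupant s y
    TPro-swap-fix {y} y≢x y≢x+1 =
      trans (TPro-nonadjacent s pointer ¬a y)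
            (cong (Inverse.from (proj₁ s)) (transpose-fix (y≢x+1 ∘ mod-% {y} {suc x}) (y≢x ∘ mod-% {y} {x})))

countBelow-mono : ∀ p {a b} → a ≤ b → countBelow p a ≤ countBelow p b
countBelow-mono p {a} {b} a≤b with m≤n⇒∃[o]m+o≡n a≤b
... | d , refl = go d
  where
    go : ∀ d → countBelow p a ≤ countBelow p (a + d)
    go zero = ≤-reflexive (cong (countBelow p) (sym (+-identityʳ a)))
    go (suc d) rewrite +-suc a d with p (a + d)
    ... | true  = m≤n⇒m≤1+n (go d)
    ... | false = go d

-- Toric promotion follows the walker

module Simulation {m n : ℕ} {T : Graph m} {K : Graph n} {v₁ : Graph.Vertex T} {v₂ : Graph.Vertex K}
                  (complete : IsComplete K) (rooting : Rooting (Graph.Adj T) v₁)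
                  {M : ℕ} (size : m + n ≡ suc M) (layout : Layout T K v₁ v₂ M) where
  open Graph T using () renaming (Vertex to VT; adj-sym to adjT-sym)
  open Graph K using () renaming (Vertex to VK)
  open Model rooting layout

  N : ℕ
  N = m + n

  G : Graph N
  G = bridgeSum T K v₁ v₂

  open Graph G using (Vertex; Adj; adj-sym)

  private instance
    N-nonZero : NonZero N
    N-nonZero = >-nonZero (subst (0 <_) (sym size) z<s)

    n-nonZero : NonZero n
    n-nonZero = nonZeroIndex j₂

  open Residues N using (+-%-injective; %-+-congʳ; %-+-cancelʳ; mod-cong; mod-%; next-mod; offset)
  open Reading G
  open Edges rooting (Graph._≟ᵛ_ T) v₂

  clique : ℕ → VK
  clique j = order (j mod n)

  clique-cong : ∀ {a b} → a % n ≡ b % n → clique a ≡ clique b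
  clique-cong eq = cong order (Residues.mod-cong n eq)

  clique-toℕ : ∀ j → clique (toℕ j) ≡ order j
  clique-toℕ j = cong order (Residues.toℕ-mod-id n j)

  clique-j₂ : clique (toℕ j₂) ≡ v₂
  clique-j₂ = trans (clique-toℕ j₂) order-j₂

  clique-≢ : ∀ a {c} → 0 < c → c < n → clique (a + c) ≢ clique a
  clique-≢ a {c} 0<c c<n eq = <⇒≢ 0<c (sym (Residues.+-%-injective n a c<n (≤-<-trans z≤n c<n)
    (trans (Residues.mod-% n {a + c} {a} (order-injective eq)) (cong (_% n) (sym (+-identityʳ a))))))

  clique-cyclicPred : ∀ j c → clique (toℕ (cyclicPred j) + suc c) ≡ clique (toℕ j + c)
  clique-cyclicPred j c = clique-cong (go j)
    where
      open ≡-Reasoning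
      go : ∀ {n} .{{_ : NonZero n}} (j : Fin n) → (toℕ (cyclicPred j) + suc c) % n ≡ (toℕ j + c) % n
      go {suc n} zero = begin
        (toℕ (fromℕ n) + suc c) % suc n ≡⟨ cong (λ k → (k + suc c) % suc n) (toℕ-fromℕ n) ⟩
        (n + suc c) % suc n             ≡⟨ cong (_% suc n) (trans (+-suc n c) (+-comm (suc n) c)) ⟩
        (c + suc n) % suc n             ≡⟨ [m+n]%n≡m%n c (suc n) ⟩
        c % suc n                       ∎
      go {suc n} (suc i) = cong (_% suc n) (trans (+-suc _ c) (cong (λ k → suc k + c) (toℕ-inject₁ i)))

  count : ℕ → ℕ
  count = countBelow (is-nothing ∘ kind)

  count-edge : ∀ {k u} → kind k ≡ just u → count (suc k) ≡ count k
  count-edge eq rewrite eq = refl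

  count-clique : ∀ {k} → kind k ≡ nothing → count (suc k) ≡ suc (count k)
  count-clique eq rewrite eq = refl

  count<n : ∀ {k} → k ≤ M → count k < n
  count<n k≤M = subst (_ ≤_) count-total (s≤s (countBelow-mono (is-nothing ∘ kind) k≤M))

  bridge-slot : ∀ {τ u} → τ < M → kind τ ≡ just u → parent u ≡ nothing → τ ≡ 0
  bridge-slot τ<M k pu = kind-injective τ<M 0<M k (trans kind-zero (cong just (sym (parent-nothing pu))))

  -- While the walker is in the tree, the clique is frozen as it was at the
  -- bridge slot, hence inj₁ reads like inj₂ j₂ at the beginning of a round.
  cliqueOccupant : Place → ℕ → ℕ → Vertex
  cliqueOccupant (inj₁ _) τ k = inj₂ (clique (toℕ j₂ + count (suc k)))
  cliqueOccupant (inj₂ j) τ k = inj₂ (clique (toℕ j + (if does (k <? τ) then count k else count (suc k))))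

  slotOccupant : Place → ℕ → ℕ → Vertex
  slotOccupant y τ k = maybe′ (λ u → edgeOccupant u (location y)) (cliqueOccupant y τ k) (kind k)

  slotOccupant-edge : ∀ {k u} → kind k ≡ just u → ∀ y τ → slotOccupant y τ k ≡ edgeOccupant u (location y)
  slotOccupant-edge eq y τ rewrite eq = refl

  slotOccupant-clique : ∀ {k} → kind k ≡ nothing → ∀ y τ → slotOccupant y τ k ≡ cliqueOccupant y τ k
  slotOccupant-clique eq y τ rewrite eq = refl

  -- A passed clique slot holds the vertex that the walker left there, one place earlier in the
  -- cyclic order than its former occupant.
  cliqueOccupant-passed : ∀ j {τ k} → k < τ → cliqueOccupant (inj₂ j) τ k ≡ inj₂ (clique (toℕ j + count k))
  cliqueOccupant-passed j {τ} {k} k<τ rewrite dec-true (k <? τ) k<τ = refl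

  cliqueOccupant-ahead : ∀ j {τ k} → τ ≤ k → cliqueOccupant (inj₂ j) τ k ≡ inj₂ (clique (toℕ j + count (suc k)))
  cliqueOccupant-ahead j {τ} {k} τ≤k rewrite dec-false (k <? τ) (≤⇒≯ τ≤k) = refl

  walker : Place → ℕ → Vertex
  walker (inj₁ w) τ = inj₁ w
  walker (inj₂ j) τ = inj₂ (clique (toℕ j + count τ))

  walker-count : ∀ y {τ υ} → count τ ≡ count υ → walker y τ ≡ walker y υ
  walker-count (inj₁ _) eq = refl
  walker-count (inj₂ j) eq = cong (λ c → inj₂ (clique (toℕ j + c))) eq

  -- The only case beyond the tree is the bridge, at slot 0, where no clique slot has been passed
  -- and the index `j₂` still means `v₂`.
  walker-parentPlace : ∀ {τ u} → τ < M → kind τ ≡ just u → walker (parentPlace u) τ ≡ above (parent u)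
  walker-parentPlace {u = u} τ<M k with parent u in pu
  ... | just p  = refl
  ... | nothing rewrite bridge-slot τ<M k pu = cong inj₂ (trans (cong clique (+-identityʳ _)) clique-j₂)

  adj-above : ∀ u → Adj (inj₁ u) (above (parent u))
  adj-above u with parent u in pu
  ... | just p  = left (parent-adj pu)
  ... | nothing rewrite parent-nothing pu = bridge₁

  bridge-ends : ∀ {c u} → Adj (inj₂ c) (inj₁ u) → c ≡ v₂ × u ≡ v₁
  bridge-ends bridge₂ = refl , refl

  -- Tree edges are parent edges, so a walker adjacent to the far end either stands at an end of the
  -- edge of `u` or contradicts the choice of the far end. From the clique only the bridge leads to
  -- a tree vertex, which forces slot 0 and `j₂`.
  nonadjacent : ∀ {τ u y} → τ < M → kind τ ≡ just u → y ≢ inj₁ u → y ≢ parentPlace u →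
                ¬ Adj (walker y τ) (edgeOccupant u (location y))
  nonadjacent {τ} {u} {inj₂ j} τ<M k y≢u y≢p a with bridge-ends a
  ... | c≡v₂ , refl =
    y≢p (trans (cong inj₂ (order-injective (begin
      order j                    ≡⟨ clique-toℕ j ⟨
      clique (toℕ j)             ≡⟨ cong clique (+-identityʳ (toℕ j)) ⟨
      clique (toℕ j + count 0)   ≡⟨ cong (λ t → clique (toℕ j + count t)) (kind-injective τ<M 0<M k kind-zero) ⟨
      clique (toℕ j + count τ)   ≡⟨ c≡v₂ ⟩
      v₂                         ≡⟨ order-j₂ ⟨
      order j₂                   ∎))) (cong (maybe′ inj₁ (inj₂ j₂)) (sym parent-root)))
    where open ≡-Reasoning
  nonadjacent {τ} {u} {inj₁ w} τ<M k y≢u y≢p a with u ≼? w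
  ... | no ¬s with a
  ...   | left wu with adj-parent wu
  ...     | inj₁ pw = ¬s (up pw self)
  ...     | inj₂ pu rewrite pu = y≢p refl
  nonadjacent {τ} {u} {inj₁ w} τ<M k y≢u y≢p a | yes s with parent u in pu | a
  ... | nothing | bridge₁ = y≢u (cong inj₁ (sym (parent-nothing pu)))
  ... | just p  | left wp with adj-parent wp
  ...   | inj₁ pw = ⋠-parent (subst (u ≼ₘ_) (trans pw (sym pu)) (≼-up (λ { refl → y≢u refl }) s))
  ...   | inj₂ pp = ⋠-parent (subst (u ≼ₘ_) (sym pu) (up pp s))

  record Exchange (y : Place) (τ : ℕ) (w x : Vertex) : Set where
    constructor exchange
    field
      walker≡ : walker y (suc τ) ≡ w
      slot≡   : slotOccupant y (suc τ) τ ≡ x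

  -- At a clique slot completeness gives adjacency to a walker in the clique, while a walker in the
  -- tree could be adjacent only to `v₂`, which is not there. At an edge slot adjacency holds
  -- exactly when the walker is at an end of that edge.
  at-slot : ∀ {τ} → τ < M → ∀ y → let w = walker y τ ; x = slotOccupant y τ τ in
            (Adj w x × Exchange (move τ y) τ x w) ⊎ (¬ Adj w x × Exchange (move τ y) τ w x)
  at-slot {τ} τ<M y = by-kind (kind τ) refl
    where
      open ≡-Reasoning
      Outcome : Place → Vertex → Vertex → Set
      Outcome z w x = (Adj w x × Exchange z τ x w) ⊎ (¬ Adj w x × Exchange z τ w x)

      by-kind : ∀ κ → kind τ ≡ κ → Outcome (move τ y) (walker y τ) (slotOccupant y τ τ)
      by-kind nothing k = subst₂ (λ z → Outcome z (walker y τ)) (sym (move-clique k y)) (sym (slotOccupant-clique k y τ)) (go y)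
        where
          c+1≡ : count (suc τ) ≡ suc (count τ)
          c+1≡ = count-clique k
          go : ∀ y → Outcome y (walker y τ) (cliqueOccupant y τ τ)
          go (inj₁ w) = inj₂ ((λ a → stays a refl) , exchange refl (slotOccupant-clique k (inj₁ w) (suc τ)))
            where
              stays : ∀ {z} → Adj (inj₁ w) (inj₂ z) → clique (toℕ j₂ + count (suc τ)) ≢ z
              stays bridge₁ eq = clique-≢ (toℕ j₂) (subst (0 <_) (sym c+1≡) z<s) (count<n τ<M) (trans eq (sym clique-j₂))
          go (inj₂ j) = inj₁ (subst (λ v → Adj (walker (inj₂ j) τ) v) (sym ahead) (right (complete _ _ distinct))
                             , exchange (sym ahead)
                                        (trans (slotOccupant-clique k (inj₂ j) (suc τ)) (cliqueOccupant-passed j {suc τ} (n<1+n τ))))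
            where
              ahead : cliqueOccupant (inj₂ j) τ τ ≡ inj₂ (clique (toℕ j + count (suc τ)))
              ahead = cliqueOccupant-ahead j {τ} ≤-refl
              distinct : clique (toℕ j + count τ) ≢ clique (toℕ j + count (suc τ))
              -- The presence of a clique slot forces `n` to exceed 1, so consecutive clique
              -- vertices differ.
              distinct eq = clique-≢ (toℕ j + count τ) {1} z<s
                (≤-trans (s≤s (s≤s z≤n)) (subst (_< n) c+1≡ (count<n τ<M)))
                (trans (cong clique (trans (+-comm _ 1) (trans (sym (+-suc (toℕ j) _)) (cong (toℕ j +_) (sym c+1≡))))) (sym eq))
      by-kind (just u) k = subst₂ (λ z → Outcome z (walker y τ)) (sym (move-edge k y)) (sym (slotOccupant-edge k y τ)) (go (crossView u y))
        where
          walker-next : ∀ z → walker z (suc τ) ≡ walker z τ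
          walker-next z = walker-count z (count-edge k)

          in-child : edgeOccupant u (just u) ≡ above (parent u)
          in-child = edgeOccupant-below self

          in-parent : edgeOccupant u (location (parentPlace u)) ≡ inj₁ u
          in-parent = edgeOccupant-beside parentPlace⋣

          at-parent : walker (parentPlace u) τ ≡ above (parent u)
          at-parent = walker-parentPlace τ<M k

          go : ∀ {y} → CrossView u y → Outcome (cross u y) (walker y τ) (edgeOccupant u (location y))
          go atChild = inj₁ (subst (Adj (inj₁ u)) (sym in-child) (adj-above u)
            , subst (λ z → Exchange z τ (edgeOccupant u (just u)) (inj₁ u)) (sym (cross-child u))
                (exchange (trans (walker-next _) (trans at-parent (sym in-child)))
                          (trans (slotOccupant-edge k (parentPlace u) (suc τ)) in-parent)))
          go atParent = inj₁ (subst₂ Adj (sym at-parent) (sym in-parent) (adj-sym (adj-above u))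
            , subst (λ z → Exchange z τ (edgeOccupant u (location (parentPlace u))) (walker (parentPlace u) τ)) (sym (cross-parent u))
                (exchange (sym in-parent)
                          (trans (slotOccupant-edge k (inj₁ u) (suc τ)) (trans in-child (sym at-parent)))))
          go (elsewhere {y} y≢u y≢p) = inj₂ (nonadjacent τ<M k y≢u y≢p
            , subst (λ z → Exchange z τ (walker y τ) (edgeOccupant u (location y))) (sym (cross-other y≢u y≢p))
                (exchange (walker-next y) (slotOccupant-edge k y (suc τ))))

  -- Crossing another edge leaves the walker on the same side of the edge in slot `k`. For a clique
  -- slot the formula changes only at the bridge; there `τ` is 0, slot `k` is still ahead, and both
  -- formulas agree.
  off-slot : ∀ {τ k} → τ < M → k < M → k ≢ τ → ∀ y → slotOccupant (move τ y) (suc τ) k ≡ slotOccupant y τ k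
  off-slot {τ} {k} τ<M k<M k≢τ y = by-kind (kind k) refl
    where
      by-kind : ∀ κ → kind k ≡ κ → slotOccupant (move τ y) (suc τ) k ≡ slotOccupant y τ k
      by-kind (just u) kk = trans (slotOccupant-edge kk _ _) (trans edge (sym (slotOccupant-edge kk _ _)))
        where
          edge : edgeOccupant u (location (move τ y)) ≡ edgeOccupant u (location y)
          edge with kind τ in kτ
          ... | nothing = refl
          ... | just u′ = edgeOccupant-cong {u} (cross-⊒⁻ y u≢u′) (cross-⊒ y u≢u′)
            where
              u≢u′ : u ≢ u′
              u≢u′ refl = k≢τ (kind-injective k<M τ<M kk kτ)
      by-kind nothing kk = trans (slotOccupant-clique kk _ _) (trans clique-slot (sym (slotOccupant-clique kk _ _)))
        where
          unmoved : ∀ z → cliqueOccupant z (suc τ) k ≡ cliqueOccupant z τ k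
          unmoved (inj₁ _) = refl
          unmoved (inj₂ j) with <-cmp k τ
          ... | tri< k<τ _ _ = trans (cliqueOccupant-passed j (m<n⇒m<1+n k<τ)) (sym (cliqueOccupant-passed j k<τ))
          ... | tri≈ _ k≡τ _ = contradiction k≡τ k≢τ
          ... | tri> _ _ τ<k = trans (cliqueOccupant-ahead j τ<k) (sym (cliqueOccupant-ahead j (<⇒≤ τ<k)))

          clique-slot : cliqueOccupant (move τ y) (suc τ) k ≡ cliqueOccupant y τ k
          clique-slot with kind τ in kτ
          ... | nothing = unmoved y
          ... | just u with crossView u y
          ...   | elsewhere y≢u y≢p rewrite cross-other y≢u y≢p = unmoved y
          ...   | atChild rewrite cross-child u with parent u in pu
          ...     | just p  = refl
          ...     | nothing rewrite bridge-slot τ<M kτ pu = cliqueOccupant-ahead j₂ (n≢0⇒n>0 k≢τ)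
          clique-slot | just u | atParent rewrite cross-parent u with parent u in pu
          ...     | just p  = refl
          ...     | nothing rewrite bridge-slot τ<M kτ pu = refl

  -- The invariant: from label `base` on come the passed slots, then the walker at offset `τ`, then
  -- the slots ahead, displaced by one. The free `base` accounts for a shift of all labels.
  record Sim (s : State G) (y : Place) (τ : ℕ) : Set where
    field
      base      : ℕ
      pointer   : proj₂ s ≡ (base + τ) mod N
      at-walker : occupant s (base + τ) ≡ walker y τ
      passed    : ∀ {k} → k < τ → occupant s (base + k) ≡ slotOccupant y τ k
      ahead     : ∀ {k} → τ ≤ k → k < M → occupant s (base + suc k) ≡ slotOccupant y τ k

  sim-≈ : ∀ {s t y τ} → _≈ₛ_ G s t → Sim s y τ → Sim t y τ
  sim-≈ {s} {t} eq sim = record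
    { base      = base
    ; pointer   = trans (sym (proj₂ eq)) pointer
    ; at-walker = trans (sym (occupant-≈ {s} {t} eq (base + _))) at-walker
    ; passed    = λ {k} lt → trans (sym (occupant-≈ {s} {t} eq (base + k))) (passed lt)
    ; ahead     = λ {k} le lt → trans (sym (occupant-≈ {s} {t} eq (base + suc k))) (ahead le lt)
    }
    where open Sim sim

  -- In the adjacent case no label changes and the advancing pointer exchanges the roles of walker
  -- and slot; otherwise the labels are swapped and the same walker goes along with the pointer.
  sim-move : ∀ {s y τ} → τ < M → Sim s y τ → Sim (TPro G s) (move τ y) (suc τ)
  sim-move {s} {y} {τ} τ<M sim with at-slot τ<M y
  ... | inj₁ (a , exchange w≡ x≡) = record
    { base      = base
    ; pointer   = trans (TPro-pointer s {base + τ} pointer) (cong (_mod N) (sym (+-suc base τ)))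
    ; at-walker = trans (same _) (trans (ahead ≤-refl τ<M) (sym w≡))
    ; passed    = λ {k} k<τ+1 → trans (same _) (passed′ k<τ+1)
    ; ahead     = λ {k} τ<k k<M → trans (same _)
        (trans (ahead (<⇒≤ τ<k) k<M) (sym (off-slot τ<M k<M (>⇒≢ τ<k) y)))
    }
    where
      open Sim sim
      same : ∀ x → occupant (TPro G s) x ≡ occupant s x
      same = TPro-adjacent s {base + τ} pointer
        (subst₂ Adj (sym at-walker)
                    (trans (sym (ahead ≤-refl τ<M)) (cong (occupant s) (+-suc base τ))) a)
      passed′ : ∀ {k} → k < suc τ → occupant s (base + k) ≡ slotOccupant (move τ y) (suc τ) k
      passed′ {k} k<τ+1 with m≤n⇒m<n∨m≡n (≤-pred k<τ+1)
      ... | inj₁ k<τ  = trans (passed k<τ) (sym (off-slot τ<M (<-trans k<τ τ<M) (<⇒≢ k<τ) y))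
      ... | inj₂ refl = trans at-walker (sym x≡)
  ... | inj₂ (¬a , exchange w≡ x≡) = record
    { base      = base
    ; pointer   = trans (TPro-pointer s {base + τ} pointer) (cong (_mod N) (sym (+-suc base τ)))
    ; at-walker = trans (cong (occupant (TPro G s)) (+-suc base τ))
        (trans (TPro-swap-right s pointer nonadj) (trans at-walker (sym w≡)))
    ; passed    = passed′
    ; ahead     = λ {k} τ<k k<M → trans
        (fix (s≤s k<M) (λ { refl → <-asym τ<k (n<1+n _) }) (λ { refl → <-irrefl refl τ<k }))
        (trans (ahead (<⇒≤ τ<k) k<M) (sym (off-slot τ<M k<M (>⇒≢ τ<k) y)))
    }
    where
      open Sim sim
      next-occupant : occupant s (suc (base + τ)) ≡ slotOccupant y τ τ
      next-occupant = trans (cong (occupant s) (sym (+-suc base τ))) (ahead ≤-refl τ<M)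
      nonadj : ¬ Adj (occupant s (base + τ)) (occupant s (suc (base + τ)))
      nonadj = ¬a ∘ subst₂ Adj at-walker next-occupant
      <N : ∀ {h} → h < suc M → h < N
      <N {h} = subst (h <_) (sym size)
      fix : ∀ {h} → h < suc M → h ≢ τ → h ≢ suc τ → occupant (TPro G s) (base + h) ≡ occupant s (base + h)
      fix {h} h<N h≢τ h≢τ+1 = TPro-swap-fix s pointer nonadj
        (h≢τ ∘ +-%-injective base (<N h<N) (<N (m<n⇒m<1+n τ<M)))
        (h≢τ+1 ∘ +-%-injective base (<N h<N) (<N (s≤s τ<M)) ∘ (λ eq → trans eq (cong (_% N) (sym (+-suc base τ)))))
      passed′ : ∀ {k} → k < suc τ → occupant (TPro G s) (base + k) ≡ slotOccupant (move τ y) (suc τ) k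
      passed′ {k} k<τ+1 with m≤n⇒m<n∨m≡n (≤-pred k<τ+1)
      ... | inj₁ k<τ  = trans (fix (<-trans k<τ (m<n⇒m<1+n τ<M)) (<⇒≢ k<τ) (<⇒≢ (m<n⇒m<1+n k<τ)))
                              (trans (passed k<τ) (sym (off-slot τ<M (<-trans k<τ τ<M) (<⇒≢ k<τ) y)))
      ... | inj₂ refl = trans (TPro-swap-left s pointer nonadj) (trans next-occupant (sym x≡))

  -- A round has one slot fewer than there are labels. The next one therefore starts from the
  -- walker's label `base + M`, and modulo `N` the old label `base + k` is `base + M + suc k`.
  sim-wrap : ∀ {s y} → Sim s y M → Sim s (wrap y) 0
  sim-wrap {s} {y} sim = record
    { base      = base + M
    ; pointer   = trans pointer (cong (_mod N) (sym (+-identityʳ _)))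
    ; at-walker = trans (cong (occupant s) (+-identityʳ _)) (trans at-walker (walker-wrap y))
    ; passed    = λ ()
    ; ahead     = λ {k} _ k<M → trans (occupant-cong s (around k)) (trans (passed k<M) (slot-wrap y k<M))
    }
    where
      open Sim sim
      open ≡-Reasoning
      around : ∀ k → (base + M + suc k) % N ≡ (base + k) % N
      around k = begin
        (base + M + suc k) % N   ≡⟨ cong (_% N) (trans (+-suc _ k) (cong (_+ k) (sym (+-suc base M)))) ⟩
        (base + suc M + k) % N   ≡⟨ cong (λ N′ → (base + N′ + k) % N) size ⟨
        (base + N + k) % N       ≡⟨ %-+-congʳ {base + N} {base} k ([m+n]%n≡m%n base N) ⟩
        (base + k) % N           ∎
      walker-wrap : ∀ y → walker y M ≡ walker (wrap y) 0
      walker-wrap (inj₁ w) = refl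
      walker-wrap (inj₂ j) = cong inj₂ (begin
        clique (toℕ j + count M)                  ≡⟨ clique-cyclicPred j (count M) ⟨
        clique (toℕ (cyclicPred j) + suc (count M)) ≡⟨ cong (λ c → clique (toℕ (cyclicPred j) + c)) count-total ⟩
        clique (toℕ (cyclicPred j) + n)           ≡⟨ clique-cong ([m+n]%n≡m%n (toℕ (cyclicPred j)) n) ⟩
        clique (toℕ (cyclicPred j))               ≡⟨ cong clique (+-identityʳ _) ⟨
        clique (toℕ (cyclicPred j) + 0)           ∎)
      clique-wrap : ∀ y {k} → k < M → kind k ≡ nothing → cliqueOccupant y M k ≡ cliqueOccupant (wrap y) 0 k
      clique-wrap (inj₁ _) k<M kk = refl
      clique-wrap (inj₂ j) {k} k<M kk = trans (cliqueOccupant-passed j k<M) (cong inj₂ (begin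
        clique (toℕ j + count k)                   ≡⟨ clique-cyclicPred j (count k) ⟨
        clique (toℕ (cyclicPred j) + suc (count k)) ≡⟨ cong (λ c → clique (toℕ (cyclicPred j) + c)) (count-clique kk) ⟨
        clique (toℕ (cyclicPred j) + count (suc k)) ∎))
      slot-wrap : ∀ y {k} → k < M → slotOccupant y M k ≡ slotOccupant (wrap y) 0 k
      slot-wrap y {k} k<M = by-kind (kind k) refl
        where
          by-kind : ∀ κ → kind k ≡ κ → slotOccupant y M k ≡ slotOccupant (wrap y) 0 k
          by-kind (just u) kk = trans (slotOccupant-edge kk y M)
            (trans (cong (edgeOccupant u) (sym (location-wrap y))) (sym (slotOccupant-edge kk (wrap y) 0)))
          by-kind nothing kk = trans (slotOccupant-clique kk y M)
            (trans (clique-wrap y k<M kk) (sym (slotOccupant-clique kk (wrap y) 0)))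

  Simulates : State G → Config → Set
  Simulates s (y , τ) = Sim s y (toℕ τ)

  sim-advance : ∀ {s y} τ → Sim s y (suc (toℕ τ)) → Simulates s (advance (y , τ))
  sim-advance {s} {y} τ sim with suc (toℕ τ) <? M
  ... | yes <M = subst (Sim s y) (sym (toℕ-fromℕ< <M)) sim
  ... | no  ≮M = subst (Sim s (wrap y)) (sym (toℕ-fromℕ< 0<M))
    (sim-wrap (subst (Sim s y) (≤-antisym (toℕ<n τ) (≮⇒≥ ≮M)) sim))

  sim-step : ∀ {s} c → Simulates s c → Simulates (TPro G s) (step c)
  sim-step (y , τ) sim = sim-advance τ (sim-move (toℕ<n τ) sim)

  sim-iterate : ∀ k {s} c → Simulates s c → Simulates (iterate (TPro G) s k) (iterate step c k)
  sim-iterate zero    c sim = sim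
  sim-iterate (suc k) c sim = sim-iterate k (step c) (sim-step c sim)

  sim-pointer : ∀ k s {x} → proj₂ s ≡ x mod N → proj₂ (iterate (TPro G) s k) ≡ (k + x) mod N
  sim-pointer zero    s     eq = eq
  sim-pointer (suc k) s {x} eq =
    trans (sim-pointer k (TPro G s) (TPro-pointer s {x} eq)) (cong (_mod N) (+-suc k x))

  -- Pointer and time give `base` modulo `N`, after which the invariant prescribes the occupant of
  -- every label.
  sim-unique : ∀ {s t y τ} → τ ≤ M → Sim s y τ → Sim t y τ → proj₂ s ≡ proj₂ t → _≈ₛ_ G s t
  sim-unique {s} {t} {y} {τ} τ≤M sim sim′ eq = ≈-from {s} {t} same eq
    where
      open Sim sim
      open Sim sim′ renaming (base to base′; pointer to pointer′; at-walker to at-walker′; passed to passed′; ahead to ahead′)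
      base≡ : base % N ≡ base′ % N
      base≡ = %-+-cancelʳ {base} {base′} τ (mod-% {base + τ} {base′ + τ} (trans (sym pointer) (trans eq pointer′)))
      shift : ∀ h → occupant t (base′ + h) ≡ occupant t (base + h)
      shift h = occupant-cong t (%-+-congʳ {base′} {base} h (sym base≡))
      at : ∀ h → h < suc M → occupant s (base + h) ≡ occupant t (base + h)
      at h h<N with <-cmp h τ
      ... | tri< h<τ _ _ = trans (passed h<τ) (trans (sym (passed′ h<τ)) (shift h))
      ... | tri≈ _ refl _ = trans at-walker (trans (sym at-walker′) (shift h))
      at (suc k) (s≤s k<M) | tri> _ _ (s≤s τ≤k) = trans (ahead τ≤k k<M) (trans (sym (ahead′ τ≤k k<M)) (shift (suc k)))
      same : ∀ i → Inverse.from (proj₁ s) i ≡ Inverse.from (proj₁ t) i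
      same i with offset base i
      ... | h , h<N , refl = at h (subst (h <_) size h<N)

  -- The walker is about to cross the bridge out of the clique. This depends on the state alone, yet
  -- it pins down the configuration.
  Crossing : State G → Set
  Crossing (σ , i) = Inverse.from σ i ≡ inj₂ v₂ × Inverse.from σ (next i) ≡ inj₁ v₁

  crossing-config : Config
  crossing-config = inj₂ j₂ , start

  -- A walker in the clique finds `v₁` only in the bridge slot, so the time is 0, and being at `v₂`
  -- then means the index `j₂`.
  crossing : ∀ {s c} → Simulates s c → Crossing s → c ≡ crossing-config
  crossing {σ , i} {y , τ} sim (w≡ , x≡) = go y
    (trans (sym at-walker) (trans (cong (Inverse.from σ) (sym pointer)) w≡))
    (trans (sym (ahead ≤-refl (toℕ<n τ)))
           (trans (cong (Inverse.from σ) (trans (trans (cong (_mod N) (+-suc base (toℕ τ))) (sym (next-mod (base + toℕ τ)))) (cong next (sym pointer)))) x≡))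
    where
      open Sim sim
      go : ∀ y → walker y (toℕ τ) ≡ inj₂ v₂ → slotOccupant y (toℕ τ) (toℕ τ) ≡ inj₁ v₁ → (y , τ) ≡ crossing-config
      go (inj₂ j) w x with kind (toℕ τ) in k
      ... | just u with inj₁-injective x
      ...   | refl with kind-injective (toℕ<n τ) 0<M k kind-zero
      ...     | τ≡0 = cong₂ _,_
        (cong inj₂ (order-injective (trans (sym (clique-toℕ j)) (trans (cong clique (sym (trans (cong (λ t → toℕ j + count t) τ≡0) (+-identityʳ _)))) (trans (inj₂-injective w) (sym order-j₂))))))
        (toℕ-injective (trans τ≡0 (sym (toℕ-fromℕ< 0<M))))

  crossing-config-crossing : ∀ {s} → Simulates s crossing-config → Crossing s
  crossing-config-crossing {σ , i} sim =
      trans (cong (Inverse.from σ) pointer) (trans at-walker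
        (cong inj₂ (trans (cong (λ t → clique (toℕ j₂ + count t)) start≡0) (trans (cong clique (+-identityʳ _)) clique-j₂))))
    , trans (cong (Inverse.from σ) (trans (cong next pointer) (trans (next-mod (base + toℕ start)) (cong (_mod N) (sym (+-suc base (toℕ start)))))))
            (trans (ahead ≤-refl (toℕ<n start)) (slotOccupant-edge (trans (cong kind start≡0) kind-zero) (inj₂ j₂) (toℕ start)))
    where
      open Sim sim
      start≡0 : toℕ start ≡ 0
      start≡0 = toℕ-fromℕ< 0<M

  orbitLength : ∀ {s} c → Simulates s c → OrbitLength G s (N * M)
  orbitLength {s} c sim = record
    { positive = >-nonZero⁻¹ (N * M) {{m*n≢0 N M {{it}} {{>-nonZero 0<M}}}}
    ; returns  = sim-unique (<⇒≤ (toℕ<n (proj₂ c)))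
        (subst (Simulates _) period′ (sim-iterate (N * M) c sim)) sim pointer-returns
    ; least    = λ k 1≤k eq → period-least (transitive c) k 1≤k (config-returns k eq)
    }
    where
      it : NonZero N
      it = N-nonZero
      open Sim sim
      open FiniteOrbit Config↔ step step-injective c
      period′ : iterate step c (N * M) ≡ c
      period′ = period (transitive c)
      pointer-returns : proj₂ (iterate (TPro G) s (N * M)) ≡ proj₂ s
      pointer-returns = trans (sim-pointer (N * M) s {base + toℕ (proj₂ c)} pointer) (trans (mod-cong
        (trans (cong (_% N) (trans (+-comm (N * M) _) (cong (base + toℕ (proj₂ c) +_) (*-comm N M))))
               ([m+kn]%n≡m%n (base + toℕ (proj₂ c)) M N))) (sym pointer))
      -- A state might a priori be described by several configurations. Both are run on to the
      -- crossing, where the configuration is determined, and the added steps are cancelled by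
      -- injectivity.
      config-returns : ∀ k → _≈ₛ_ G (iterate (TPro G) s k) s → iterate step c k ≡ c
      config-returns k eq with transitive c crossing-config
      ... | t , reached = iterate-injective step step-injective t (trans
        (crossing (sim-iterate t (iterate step c k) (sim-≈ eq (sim-iterate k c sim)))
                  (crossing-config-crossing (subst (Simulates _) reached (sim-iterate t c sim))))
        (sym reached))

-- Enumeration by a Boolean predicate

countBelow-true : ∀ p {k} → p k ≡ true → countBelow p (suc k) ≡ suc (countBelow p k)
countBelow-true p eq rewrite eq = refl

countBelow-strict : ∀ p {a b} → p a ≡ true → a < b → countBelow p a < countBelow p b
countBelow-strict p {a} {b} pa a<b =
  subst (_≤ countBelow p b) (countBelow-true p pa) (countBelow-mono p a<b)

countBelow-injective : ∀ p {a b} → p a ≡ true → p b ≡ true → countBelow p a ≡ countBelow p b → a ≡ b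
countBelow-injective p {a} {b} pa pb eq with <-cmp a b
... | tri< a<b _ _ = contradiction eq (<⇒≢ (countBelow-strict p pa a<b))
... | tri≈ _ a≡b _ = a≡b
... | tri> _ _ b<a = contradiction (sym eq) (<⇒≢ (countBelow-strict p pb b<a))

countBelow-surjective : ∀ p h {j} → j < countBelow p h → ∃[ k ] k < h × p k ≡ true × countBelow p k ≡ j
countBelow-surjective p (suc h) {j} j<c with p h in ph
... | false with countBelow-surjective p h j<c
...   | k , k<h , r = k , m<n⇒m<1+n k<h , r
countBelow-surjective p (suc h) {j} j<c | true with m≤n⇒m<n∨m≡n (≤-pred j<c)
... | inj₂ refl = h , n<1+n h , ph , refl
... | inj₁ j<c′ with countBelow-surjective p h j<c′
...   | k , k<h , r = k , m<n⇒m<1+n k<h , r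

-- Serves to compare clique slots with clique vertices along the labels: the two counts keep a
-- constant difference `d`.
countBelow-step : ∀ p q {a b} → p a ≡ q b → ∀ {d} → d + countBelow p a ≡ countBelow q b →
                  d + countBelow p (suc a) ≡ countBelow q (suc b)
countBelow-step p q {a} {b} eq {d} ih with p a | q b | eq
... | true  | true  | refl = trans (+-suc d _) (cong suc ih)
... | false | false | refl = ih

-- The configuration of an arbitrary state

module Initial {m n : ℕ} {T : Graph m} {K : Graph n} {v₁ : Graph.Vertex T} {v₂ : Graph.Vertex K}
               (complete : IsComplete K) (rooting : Rooting (Graph.Adj T) v₁)
               {M : ℕ} (size : m + n ≡ suc M) (s : State (bridgeSum T K v₁ v₂)) where
  open Graph T using () renaming (Vertex to VT)
  open Graph K using () renaming (Vertex to VK; finite to finiteK)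
  open Rooting rooting
  open Edges rooting (Graph._≟ᵛ_ T) v₂

  G : Graph (m + n)
  G = bridgeSum T K v₁ v₂

  open Graph G using (Vertex; _≟ᵛ_)

  private
    N = m + n
    instance
      N-nonZero : NonZero N
      N-nonZero = >-nonZero (subst (0 <_) (sym size) z<s)

  open Residues N
  open Reading G
  open Inverse (proj₁ s)

  w₀ : Vertex
  w₀ = from (proj₂ s)

  treePart : Vertex → Maybe VT
  treePart (inj₁ w) = just w
  treePart (inj₂ _) = nothing

  treePart-just : ∀ {x z} → treePart x ≡ just z → x ≡ inj₁ z
  treePart-just {inj₁ _} refl = refl

  inClique : Vertex → Bool
  inClique (inj₁ _) = false
  inClique (inj₂ _) = true

  inClique-true : ∀ {x} → inClique x ≡ true → ∃[ c ] x ≡ inj₂ c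
  inClique-true {inj₂ c} _ = c , refl

  -- The end of the bridge farther from the walker, which is what the bridge slot must hold.
  farEnd : Vertex → Vertex
  farEnd (inj₁ _) = inj₂ v₂
  farEnd (inj₂ _) = inj₁ v₁

  -- Rounds begin at the bridge slot, so labels are read from its occupant on.
  base : ℕ
  base = toℕ (to (farEnd w₀))

  reading : ℕ → Vertex
  reading h = occupant s (base + h)

  reading-zero : reading 0 ≡ farEnd w₀
  reading-zero = trans (cong from (trans (cong (_mod N) (+-identityʳ base)) (toℕ-mod-id (to (farEnd w₀)))))
                       (strictlyInverseʳ _)

  reading-injective : ∀ {h k} → h < N → k < N → reading h ≡ reading k → h ≡ k
  reading-injective {h} {k} h<N k<N eq = +-%-injective base h<N k<N (mod-% {base + h} {base + k}
    (trans (sym (strictlyInverseˡ _)) (trans (cong to eq) (strictlyInverseˡ _))))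

  reading-surjective : ∀ x → ∃[ h ] h < N × reading h ≡ x
  reading-surjective x with offset base (to x)
  ... | h , h<N , eq = h , h<N , trans (cong from eq) (strictlyInverseʳ x)

  τ₀ : ℕ
  τ₀ = proj₁ (offset base (proj₂ s))

  τ₀<N : τ₀ < N
  τ₀<N = proj₁ (proj₂ (offset base (proj₂ s)))

  pointer₀ : (base + τ₀) mod N ≡ proj₂ s
  pointer₀ = proj₂ (proj₂ (offset base (proj₂ s)))

  reading-τ₀ : reading τ₀ ≡ w₀
  reading-τ₀ = cong from pointer₀

  0<τ₀ : 0 < τ₀
  0<τ₀ = n≢0⇒n>0 λ eq → farEnd≢ w₀ (trans (sym reading-zero) (trans (cong reading (sym eq)) reading-τ₀))
    where
      farEnd≢ : ∀ x → farEnd x ≢ x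
      farEnd≢ (inj₁ _) ()
      farEnd≢ (inj₂ _) ()

  -- The offsets other than the walker's, numbered without the gap at `τ₀`; the two cases match
  -- `passed` and `ahead` in `Sim`.
  position : ℕ → ℕ
  position k = if does (k <? τ₀) then k else suc k

  position-passed : ∀ {k} → k < τ₀ → position k ≡ k
  position-passed {k} lt rewrite dec-true (k <? τ₀) lt = refl

  position-ahead : ∀ {k} → τ₀ ≤ k → position k ≡ suc k
  position-ahead {k} le rewrite dec-false (k <? τ₀) (≤⇒≯ le) = refl

  positionView : ∀ k → (k < τ₀ × position k ≡ k) ⊎ (τ₀ ≤ k × position k ≡ suc k)
  positionView k with <-≤-connex k τ₀
  ... | inj₁ lt = inj₁ (lt , position-passed lt)
  ... | inj₂ le = inj₂ (le , position-ahead le)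

  position<N : ∀ {k} → k < M → position k < N
  position<N {k} k<M with positionView k
  ... | inj₁ (_ , eq) = subst₂ _<_ (sym eq) (sym size) (m<n⇒m<1+n k<M)
  ... | inj₂ (_ , eq) = subst₂ _<_ (sym eq) (sym size) (s≤s k<M)

  position≢τ₀ : ∀ k → position k ≢ τ₀
  position≢τ₀ k eq with positionView k
  ... | inj₁ (lt , p) = <⇒≢ lt (trans (sym p) eq)
  ... | inj₂ (le , p) = <⇒≢ (s≤s le) (trans (sym eq) p)

  position-injective : ∀ {k k′} → position k ≡ position k′ → k ≡ k′
  position-injective {k} {k′} eq with positionView k | positionView k′
  ... | inj₁ (_ , p) | inj₁ (_ , q) = trans (sym p) (trans eq q)
  ... | inj₁ (lt , p) | inj₂ (le , q) = contradiction (trans (sym p) (trans eq q)) (<⇒≢ (m<n⇒m<1+n (<-≤-trans lt le)))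
  ... | inj₂ (le , p) | inj₁ (lt , q) = contradiction (trans (sym q) (trans (sym eq) p)) (<⇒≢ (m<n⇒m<1+n (<-≤-trans lt le)))
  ... | inj₂ (_ , p) | inj₂ (_ , q) = suc-injective (trans (sym p) (trans eq q))

  position-surjective : ∀ {h} → h < N → h ≢ τ₀ → ∃[ k ] k < M × position k ≡ h
  position-surjective {h} h<N h≢τ₀ with <-cmp h τ₀
  ... | tri< h<τ₀ _ _ = h , <-≤-trans h<τ₀ (≤-pred (subst (τ₀ <_) size τ₀<N)) , position-passed h<τ₀
  ... | tri≈ _ eq _   = contradiction eq h≢τ₀
  position-surjective {suc h} h<N h≢τ₀ | tri> _ _ (s≤s τ₀≤h) =
    h , ≤-pred (subst (suc h <_) size h<N) , position-ahead τ₀≤h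

  abstract
    -- A slot is classified by its present occupant: it belongs to the edge whose far end that is,
    -- unique by `edgeOccupant-injective`, or else to the clique.
    kindOf : Vertex → Maybe VT
    kindOf x with any-vertex? T (λ u → edgeOccupant u (treePart w₀) ≟ᵛ x)
    ... | yes (u , _) = just u
    ... | no  _       = nothing

    kindOf-just : ∀ {x u} → kindOf x ≡ just u → edgeOccupant u (treePart w₀) ≡ x
    kindOf-just {x} eq with any-vertex? T (λ u → edgeOccupant u (treePart w₀) ≟ᵛ x)
    kindOf-just {x} refl | yes (u , p) = p

    kindOf-nothing : ∀ {x} → kindOf x ≡ nothing → ∀ u → edgeOccupant u (treePart w₀) ≢ x
    kindOf-nothing {x} eq u p with any-vertex? T (λ u → edgeOccupant u (treePart w₀) ≟ᵛ x)
    ... | no ¬q = ¬q (u , p)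

  kindOf-edge : ∀ {x} u → edgeOccupant u (treePart w₀) ≡ x → kindOf x ≡ just u
  kindOf-edge {x} u p with kindOf x in eq
  ... | just u′ = cong just (edgeOccupant-injective {l = treePart w₀} (trans (kindOf-just eq) (sym p)))
  ... | nothing = contradiction p (kindOf-nothing eq u)

  kindOf-clique : ∀ {x} → x ≢ w₀ → kindOf x ≡ nothing → ∃[ c ] x ≡ inj₂ c
  kindOf-clique {inj₂ c} _ _ = c , refl
  kindOf-clique {inj₁ z} x≢w₀ eq with edgeOccupant-tree (treePart w₀) (x≢w₀ ∘ sym ∘ treePart-just)
  ... | u , p = contradiction p (kindOf-nothing eq u)

  -- The one clique vertex that can sit in an edge slot is `v₂`, and only while the walker is in the
  -- tree.
  kindOf-inClique : ∀ {x} → x ≢ w₀ → (treePart w₀ ≡ nothing ⊎ x ≢ inj₂ v₂) →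
                    is-nothing (kindOf x) ≡ inClique x
  kindOf-inClique {x} x≢w₀ cond with kindOf x in eq
  kindOf-inClique {x} x≢w₀ cond | nothing with kindOf-clique x≢w₀ eq
  ... | c , refl = refl
  kindOf-inClique {inj₁ z} x≢w₀ cond | just u = refl
  kindOf-inClique {inj₂ c} x≢w₀ cond | just u
    with edgeOccupant-hub {u} {treePart w₀} (kindOf-just eq) | cond
  ... | l≢ , _    | inj₁ l≡ = contradiction l≡ l≢
  ... | _  , refl | inj₂ ≢h = contradiction refl ≢h

  kind : ℕ → Maybe VT
  kind k = kindOf (reading (position k))

  slot≢w₀ : ∀ {k} → k < M → reading (position k) ≢ w₀
  slot≢w₀ {k} k<M eq = position≢τ₀ k (reading-injective (position<N k<M) τ₀<N (trans eq (sym reading-τ₀)))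

  kind-injective : ∀ {k k′ u} → k < M → k′ < M → kind k ≡ just u → kind k′ ≡ just u → k ≡ k′
  kind-injective k<M k′<M eq eq′ = position-injective
    (reading-injective (position<N k<M) (position<N k′<M) (trans (sym (kindOf-just eq)) (kindOf-just eq′)))

  slot : ∀ u → ∃[ k ] k < M × kind k ≡ just u
  slot u with reading-surjective (edgeOccupant u (treePart w₀))
  ... | h , h<N , eq with position-surjective h<N
                            (λ { refl → edge≢w₀ (trans (sym eq) reading-τ₀) })
    where
      edge≢w₀ : edgeOccupant u (treePart w₀) ≢ w₀
      edge≢w₀ p with w₀
      ... | inj₁ w = edgeOccupant-≢walker {u} p
      edge≢w₀ () | inj₂ c
  ...   | k , k<M , refl = k , k<M , kindOf-edge u (sym eq)

  kind-zero : kind 0 ≡ just v₁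
  kind-zero = kindOf-edge v₁ (trans bridge (sym (trans (cong reading (position-passed 0<τ₀)) reading-zero)))
    where
      bridge : edgeOccupant v₁ (treePart w₀) ≡ farEnd w₀
      bridge with w₀
      ... | inj₁ w = edgeOccupant-root w
      ... | inj₂ _ = refl

  count : ℕ → ℕ
  count = countBelow (is-nothing ∘ kind)

  -- At an offset occupied by a clique vertex, this is the index of that vertex in the cyclic order
  -- to be constructed.
  rank : ℕ → ℕ
  rank = countBelow (inClique ∘ reading)

  slot-inClique : ∀ {k} → k < M → (treePart w₀ ≡ nothing ⊎ 0 < k) →
                  is-nothing (kind k) ≡ inClique (reading (position k))
  slot-inClique {k} k<M cond = kindOf-inClique (slot≢w₀ k<M) (cond′ w₀ refl cond)
    where
      cond′ : ∀ x → w₀ ≡ x → (treePart w₀ ≡ nothing ⊎ 0 < k) → treePart w₀ ≡ nothing ⊎ reading (position k) ≢ inj₂ v₂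
      cond′ _        _  (inj₁ eq)  = inj₁ eq
      cond′ (inj₂ _) w≡ (inj₂ 0<k) = inj₁ (cong treePart w≡)
      cond′ (inj₁ _) w≡ (inj₂ 0<k) = inj₂ λ eq → <⇒≢ 0<k (sym (position-injective
        (reading-injective (position<N k<M) (position<N (≤-<-trans z≤n k<M))
          (trans eq (sym (trans (cong reading (position-passed 0<τ₀)) (trans reading-zero (cong farEnd w≡))))))))

  τ₀≤M : τ₀ ≤ M
  τ₀≤M = ≤-pred (subst (τ₀ <_) size τ₀<N)

  passed-rank-clique : treePart w₀ ≡ nothing → ∀ k → k ≤ τ₀ → count k ≡ rank k
  passed-rank-clique eq zero    _ = refl
  passed-rank-clique eq (suc k) lt = countBelow-step (is-nothing ∘ kind) (inClique ∘ reading)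
    (trans (slot-inClique (<-≤-trans lt τ₀≤M) (inj₁ eq)) (cong (inClique ∘ reading) (position-passed lt)))
    {0} (passed-rank-clique eq k (<⇒≤ lt))

  -- With the walker in the tree, `v₂` at offset 0 is counted by `rank` although its slot is the
  -- bridge; hence the difference of one from offset 1 on.
  passed-rank-tree : ∀ {w} → w₀ ≡ inj₁ w → ∀ k → k < τ₀ → suc (count (suc k)) ≡ rank (suc k)
  passed-rank-tree eq zero lt
    rewrite kind-zero | trans reading-zero (cong farEnd eq) = refl
  passed-rank-tree eq (suc k) lt = countBelow-step (is-nothing ∘ kind) (inClique ∘ reading)
    (trans (slot-inClique (<-≤-trans lt τ₀≤M) (inj₂ z<s)) (cong (inClique ∘ reading) (position-passed lt)))
    {1} (passed-rank-tree eq k (<-trans (n<1+n k) lt))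

  -- The additional clique vertex is the walker itself if it is in the clique, and `v₂` in the
  -- bridge slot otherwise.
  rank-τ₀ : suc (count τ₀) ≡ rank (suc τ₀)
  rank-τ₀ = by-walker w₀ refl
    where
      before : ∀ {w} → w₀ ≡ inj₁ w → ∀ k → 0 < k → k ≤ τ₀ → suc (count k) ≡ rank k
      before w≡ (suc k) _ le = passed-rank-tree w≡ k le

      by-walker : ∀ x → w₀ ≡ x → suc (count τ₀) ≡ rank (suc τ₀)
      by-walker (inj₂ c) w≡ rewrite trans reading-τ₀ w≡ = cong suc (passed-rank-clique (cong treePart w≡) τ₀ ≤-refl)
      by-walker (inj₁ w) w≡ rewrite trans reading-τ₀ w≡ = before w≡ τ₀ 0<τ₀ ≤-refl

  ahead-rank : ∀ {k} → τ₀ ≤ k → k ≤ M → suc (count k) ≡ rank (suc k)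
  ahead-rank {k} τ₀≤k k≤M with m≤n⇒∃[o]m+o≡n τ₀≤k
  ... | d , refl = go d k≤M
    where
      go : ∀ d → τ₀ + d ≤ M → suc (count (τ₀ + d)) ≡ rank (suc (τ₀ + d))
      go zero    _  rewrite +-identityʳ τ₀ = rank-τ₀
      go (suc d) le rewrite +-suc τ₀ d = countBelow-step (is-nothing ∘ kind) (inClique ∘ reading)
        (trans (slot-inClique le (inj₂ (<-≤-trans 0<τ₀ (m≤m+n τ₀ d))))
               (cong (inClique ∘ reading) (position-ahead (m≤m+n τ₀ d))))
        {1} (go d (<⇒≤ le))

  private
    in-clique : ∀ {h c} → reading h ≡ inj₂ c → inClique (reading h) ≡ true
    in-clique eq = cong inClique eq

  Nth : ℕ → Set
  Nth j = ∃[ h ] h < N × ∃[ c ] reading h ≡ inj₂ c × rank h ≡ j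

  abstract
    nth : ∀ {j} → j < rank N → Nth j
    nth lt with countBelow-surjective (inClique ∘ reading) N lt
    ... | h , h<N , p , eq with inClique-true p
    ...   | c , r = h , h<N , c , r , eq

  vertex : ∀ {j} → Nth j → VK
  vertex (_ , _ , c , _) = c

  vertex-rank : ∀ {j h c} (x : Nth j) → reading h ≡ inj₂ c → rank h ≡ j → vertex x ≡ c
  vertex-rank (h′ , _ , c′ , r′ , eq′) r eq
    with countBelow-injective (inClique ∘ reading) (in-clique r) (in-clique r′) (trans eq (sym eq′))
  ... | refl = inj₂-injective (trans (sym r′) r)

  vertex-injective : ∀ {j k} (x : Nth j) (y : Nth k) → vertex x ≡ vertex y → j ≡ k
  vertex-injective (h , h<N , c , r , p) (h′ , h′<N , c′ , r′ , p′) eq =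
    trans (sym p) (trans (cong rank (reading-injective h<N h′<N (trans r (trans (cong inj₂ eq) (sym r′))))) p′)

  abstract
    find : ∀ c → ∃[ h ] h < N × reading h ≡ inj₂ c
    find c = reading-surjective (inj₂ c)

  rank<rank : ∀ {h c} → h < N → reading h ≡ inj₂ c → rank h < rank N
  rank<rank h<N r = countBelow-strict (inClique ∘ reading) (in-clique r) h<N

  -- Taking the vertex of a given rank, and the rank of a given vertex, are injections in opposite
  -- directions.
  rank-total : rank N ≡ n
  rank-total = ≤-antisym
    (injective⇒≤ {f = λ j → K.to (vertex (nth (toℕ<n j)))} λ {j} {k} eq →
      toℕ-injective (vertex-injective (nth (toℕ<n j)) (nth (toℕ<n k)) (K-to-injective eq)))
    (injective⇒≤ {f = index} λ {i} {j} eq → index-injective i j eq)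
    where
      module K = Inverse finiteK
      K-to-injective : ∀ {a b} → K.to a ≡ K.to b → a ≡ b
      K-to-injective {a} {b} eq = trans (sym (K.strictlyInverseʳ a)) (trans (cong K.from eq) (K.strictlyInverseʳ b))
      found : ∀ i → reading (proj₁ (find (K.from i))) ≡ inj₂ (K.from i)
      found i = proj₂ (proj₂ (find (K.from i)))
      found<rank : ∀ i → rank (proj₁ (find (K.from i))) < rank N
      found<rank i = rank<rank (proj₁ (proj₂ (find (K.from i)))) (found i)
      index : Fin n → Fin (rank N)
      index i = fromℕ< (found<rank i)
      index-injective : ∀ i j → index i ≡ index j → i ≡ j
      index-injective i j eq = begin
        i               ≡⟨ K.strictlyInverseˡ i ⟨
        K.to (K.from i) ≡⟨ cong K.to (inj₂-injective (trans (sym (found i)) (trans (cong reading same) (found j)))) ⟩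
        K.to (K.from j) ≡⟨ K.strictlyInverseˡ j ⟩
        j               ∎
        where
          open ≡-Reasoning
          same : proj₁ (find (K.from i)) ≡ proj₁ (find (K.from j))
          same = countBelow-injective (inClique ∘ reading) (in-clique (found i)) (in-clique (found j))
                                      (fromℕ<-injective _ _ (found<rank i) (found<rank j) eq)

  rank<n : ∀ {h c} → h < N → reading h ≡ inj₂ c → rank h < n
  rank<n {h} h<N r = subst (rank h <_) rank-total (rank<rank h<N r)

  j₂ : Fin n
  j₂ = fromℕ< (rank<n (proj₁ (proj₂ (find v₂))) (proj₂ (proj₂ (find v₂))))

  order : Fin n → VK
  order j = vertex (nth (subst (toℕ j <_) (sym rank-total) (toℕ<n j)))

  order-rank : ∀ {j h c} → reading h ≡ inj₂ c → rank h ≡ toℕ j → order j ≡ c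
  order-rank r eq = vertex-rank (nth _) r eq

  layout : Layout T K v₁ v₂ M
  layout = record
    { kind            = kind
    ; kind-injective  = kind-injective
    ; slot            = slot
    ; kind-zero       = kind-zero
    ; count-total     = trans (ahead-rank τ₀≤M ≤-refl) (trans (cong rank (sym size)) rank-total)
    ; order           = order
    ; order-injective = λ {j} {k} eq → toℕ-injective (vertex-injective (nth _) (nth _) eq)
    ; j₂              = j₂
    ; order-j₂        = order-rank (proj₂ (proj₂ (find v₂))) (sym (toℕ-fromℕ< _))
    }

  open Simulation {v₁ = v₁} complete rooting size layout
    using (clique; cliqueOccupant; cliqueOccupant-passed; cliqueOccupant-ahead; slotOccupant; slotOccupant-edge; slotOccupant-clique;
           count-clique; walker; Sim; Simulates; sim-advance)
  open Model rooting layout using (Place; Config; location; advance)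

  0<n : 0 < n
  0<n = ≤-<-trans z≤n (toℕ<n j₂)

  clique-rank : ∀ {h c} → h < N → reading h ≡ inj₂ c → clique (rank h) ≡ c
  clique-rank {h} h<N r = order-rank r (sym (trans (toℕ-fromℕ< _) (m<n⇒m%n≡m {{_}} (rank<n h<N r))))

  -- The cyclic order is listed from offset 0 on, so a walker in the clique whose index is now
  -- `count τ₀` began the round at index 0.
  y₀ : Vertex → Place
  y₀ (inj₁ w) = inj₁ w
  y₀ (inj₂ _) = inj₂ (fromℕ< 0<n)

  location-y₀ : ∀ x → location (y₀ x) ≡ treePart x
  location-y₀ (inj₁ _) = refl
  location-y₀ (inj₂ _) = refl

  toℕ-j₂ : ∀ {w} → w₀ ≡ inj₁ w → toℕ j₂ ≡ 0
  toℕ-j₂ w≡ = trans (toℕ-fromℕ< _) (cong rank (reading-injective (proj₁ (proj₂ (find v₂))) (≤-<-trans z≤n τ₀<N)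
    (trans (proj₂ (proj₂ (find v₂))) (sym (trans reading-zero (cong farEnd w≡))))))

  walker₀ : ∀ {x} → w₀ ≡ x → w₀ ≡ walker (y₀ x) τ₀
  walker₀ {inj₁ w} w≡ = w≡
  walker₀ {inj₂ c} w≡ = trans w≡ (cong inj₂ (sym (begin
    clique (toℕ (fromℕ< 0<n) + count τ₀) ≡⟨ cong (λ j → clique (j + count τ₀)) (toℕ-fromℕ< 0<n) ⟩
    clique (count τ₀)                    ≡⟨ cong clique (passed-rank-clique (cong treePart w≡) τ₀ ≤-refl) ⟩
    clique (rank τ₀)                     ≡⟨ clique-rank τ₀<N (trans reading-τ₀ w≡) ⟩
    c                                    ∎)))
    where open ≡-Reasoning

  clique-passed₀ : ∀ {x c k} → w₀ ≡ x → kind k ≡ nothing → k < τ₀ → reading k ≡ inj₂ c →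
                   cliqueOccupant (y₀ x) τ₀ k ≡ inj₂ c
  clique-passed₀ {inj₁ w} {c} {zero} w≡ kk k<τ₀ r = contradiction (trans (sym kind-zero) kk) λ ()
  clique-passed₀ {inj₁ w} {c} {suc k} w≡ kk k<τ₀ r = cong inj₂ (begin
    clique (toℕ j₂ + count (2+ k)) ≡⟨ cong₂ (λ a b → clique (a + b)) (toℕ-j₂ w≡) (count-clique {suc k} kk) ⟩
    clique (suc (count (suc k)))   ≡⟨ cong clique (passed-rank-tree w≡ k (<-trans (n<1+n k) k<τ₀)) ⟩
    clique (rank (suc k))          ≡⟨ clique-rank (<-trans k<τ₀ τ₀<N) r ⟩
    c                              ∎)
    where open ≡-Reasoning
  clique-passed₀ {inj₂ _} {c} {k} w≡ kk k<τ₀ r = trans (cliqueOccupant-passed (fromℕ< 0<n) k<τ₀) (cong inj₂ (begin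
    clique (toℕ (fromℕ< 0<n) + count k) ≡⟨ cong (λ j → clique (j + count k)) (toℕ-fromℕ< 0<n) ⟩
    clique (count k)                    ≡⟨ cong clique (passed-rank-clique (cong treePart w≡) k (<⇒≤ k<τ₀)) ⟩
    clique (rank k)                     ≡⟨ clique-rank (<-trans k<τ₀ τ₀<N) r ⟩
    c                                   ∎))
    where open ≡-Reasoning

  clique-ahead₀ : ∀ {x c k} → w₀ ≡ x → kind k ≡ nothing → τ₀ ≤ k → k < M → reading (suc k) ≡ inj₂ c →
                  cliqueOccupant (y₀ x) τ₀ k ≡ inj₂ c
  clique-ahead₀ {x} {c} {k} w≡ kk τ₀≤k k<M r = trans (at x w≡) (cong inj₂ (begin
    clique (count (suc k)) ≡⟨ cong clique (trans (count-clique {k} kk) (ahead-rank τ₀≤k (<⇒≤ k<M))) ⟩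
    clique (rank (suc k))  ≡⟨ clique-rank (subst (suc k <_) (sym size) (s≤s k<M)) r ⟩
    c                      ∎))
    where
      open ≡-Reasoning
      at : ∀ x → w₀ ≡ x → cliqueOccupant (y₀ x) τ₀ k ≡ inj₂ (clique (count (suc k)))
      at (inj₁ _) w≡ = cong (λ j → inj₂ (clique (j + count (suc k)))) (toℕ-j₂ w≡)
      at (inj₂ _) w≡ = trans (cliqueOccupant-ahead (fromℕ< 0<n) τ₀≤k)
                             (cong (λ j → inj₂ (clique (j + count (suc k)))) (toℕ-fromℕ< 0<n))

  slot₀ : ∀ {k} → k < M →
          (∀ {c} → kind k ≡ nothing → reading (position k) ≡ inj₂ c → cliqueOccupant (y₀ w₀) τ₀ k ≡ inj₂ c) →
          reading (position k) ≡ slotOccupant (y₀ w₀) τ₀ k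
  slot₀ {k} k<M clique-slot = by-kind (kind k) refl
    where
      by-kind : ∀ κ → kind k ≡ κ → reading (position k) ≡ slotOccupant (y₀ w₀) τ₀ k
      by-kind (just u) kk = trans (sym (kindOf-just kk))
        (trans (cong (edgeOccupant u) (sym (location-y₀ w₀))) (sym (slotOccupant-edge {k} kk (y₀ w₀) τ₀)))
      by-kind nothing kk with kindOf-clique (slot≢w₀ k<M) kk
      ... | c , r = trans r (trans (sym (clique-slot kk r)) (sym (slotOccupant-clique {k} kk (y₀ w₀) τ₀)))

  sim₀ : Sim s (y₀ w₀) τ₀
  sim₀ = record
    { base      = base
    ; pointer   = sym pointer₀
    ; at-walker = trans reading-τ₀ (walker₀ refl)
    ; passed    = λ {k} k<τ₀ → trans (cong reading (sym (position-passed k<τ₀)))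
        (slot₀ (<-≤-trans k<τ₀ τ₀≤M) λ kk r →
          clique-passed₀ refl kk k<τ₀ (trans (cong reading (sym (position-passed k<τ₀))) r))
    ; ahead     = λ {k} τ₀≤k k<M → trans (cong reading (sym (position-ahead τ₀≤k)))
        (slot₀ k<M λ kk r →
          clique-ahead₀ refl kk τ₀≤k k<M (trans (cong reading (sym (position-ahead τ₀≤k))) r))
    }

  initial : ∃[ c ] Simulates s c
  initial = go τ₀ 0<τ₀ τ₀≤M sim₀
    where
      go : ∀ τ → 0 < τ → τ ≤ M → Sim s (y₀ w₀) τ → ∃[ c ] Simulates s c
      -- `τ₀` may equal `M`, which is no valid time; describing the state as the advance of time `t`
      -- lets `advance` do the wrapping.
      go (suc t) _ t<M sim = advance (y₀ w₀ , fromℕ< t<M) , sim-advance (fromℕ< t<M)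
        (subst (Sim s (y₀ w₀)) (cong suc (sym (toℕ-fromℕ< t<M))) sim)

theorem8 : ∀ (m n : ℕ) → 1 ≤ m → 1 ≤ n →
    (T : Graph m) → IsTree T →
    (K : Graph n) → IsComplete K →
    (v₁ : Graph.Vertex T) (v₂ : Graph.Vertex K) →
    (s : State (bridgeSum T K v₁ v₂)) →
    OrbitLength (bridgeSum T K v₁ v₂) s ((m + n) * (m + n ∸ 1))
theorem8 (suc m) n 1≤m 1≤n T tree K complete v₁ v₂ s =
  -- The tree is rooted at its end of the bridge, and the layout is read off the given state. As the
  -- tree has `suc m` vertices, `M` is `m + n` and `size` holds by `refl`.
  Simulation.orbitLength complete root refl (Initial.layout complete root refl s) _ (proj₂ (Initial.initial complete root refl s))
  where root = rooting T tree v₁
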